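{- $\mathrm{NGSM}\cap\mathrm{NMSO}_e=\mathrm{NGSM}_{fin}$.
   Context: 2gsm: $M=(Q,\Sigma_1,\Sigma_2,\delta,q_{in},q_f)$ with finite $Q$ and instructions $(p,\sigma,q_1,\alpha_1,\epsilon_1,q_0,\alpha_0,\epsilon_0)$, $p\ne q_f$, $\sigma\in\Sigma_1\cup\{\vdash,\dashv\}$, $\alpha_i\in\Sigma_2^*$, $\epsilon_i\in\{ -1,0,+1\}$; on input $w$ the read-only tape holds $\vdash w\dashv$; in state $p$ scanning $\tau$ any instruction starting with $p$ may be executed: enter $q_1$, output $\alpha_1$, move by $\epsilon_1$ if $\tau=\sigma$, otherwise use $(q_0,\alpha_0,\epsilon_0)$; $(w,z)$ is realized iff some computation from $q_{in}$ at position $0$ reaches $q_f$ with output $z$. $\mathrm{NGSM}$: transductions realized by 2gsm's. A computation is $k$-visiting if each tape position is visited at most $k$ times; $M$ is finite visit if for some $k$ every realized pair $(w,z)$ has a $k$-visiting computation; $\mathrm{NGSM}_{fin}$: transductions realized by finite visit 2gsm's. Graphs $(V,E,\mathrm{lab})$, $E\subseteq V\times\Gamma\times V$ ($*$ = unlabelled); MSO logic with atomic formulas $\mathrm{lab}_\sigma(x)$, $\mathrm{edge}_\gamma(x,y)$, $x=y$, $x\in X$. A nondeterministic mso definable graph transduction: parameters $X_1,\dots,X_k$, domain formula $\varphi_{dom}(\bar X)$, finite copy set $C$, node formulas $\varphi^c_\sigma(x,\bar X)$, edge formulas $\varphi^{c_1,c_2}_\gamma(x,y,\bar X)$; for each valuation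 $\bar U$ of the parameters by node sets of input $g$ with $g\models\varphi_{dom}(\bar U)$ the output has nodes $(u,c)$ with exactly one $\sigma$ such that $g\models\varphi^c_\sigma(u,\bar U)$ (labelled $\sigma$) and edges $((u,c_1),\gamma,(v,c_2))$ iff $g\models\varphi^{c_1,c_2}_\gamma(u,v,\bar U)$. For $w=a_1\cdots a_k$, $\mathrm{egr}(w)$ has unlabelled nodes $v_0,\dots,v_k$ and edges $(v_{i-1},a_i,v_i)$. $\mathrm{NMSO}_e$: string transductions $m$ with $\{(\mathrm{egr}(w),\mathrm{egr}(z)):(w,z)\in m\}$ a nondeterministic mso definable graph transduction. -}

module Defs where

open import Data.Nat as ℕ using (ℕ; zero; suc; _≤_)
open import Data.Fin as Fin using (Fin; zero; suc)
open import Data.Bool using (Bool; true; false; not; _∧_; _∨_; if_then_else_; T)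
open import Data.List using (List; []; _∷_; _++_; [_]; map; length; filter; allFin; concatMap)
open import Data.Bool.ListAction using (any; all)
open import Data.Nat.ListAction using (sum)
open import Data.List.Membership.Propositional using (_∈_)
open import Data.List.Relation.Unary.All using (All)
open import Data.Maybe using (Maybe; just; nothing)
open import Data.Product using (Σ; ∃; _×_; _,_; proj₁)
open import Relation.Nullary using (¬_)
open import Relation.Nullary.Decidable using (⌊_⌋)
open import Relation.Binary.PropositionalEquality using (_≡_; _≢_)
open import Function.Bundles using (_↔_; _⇔_; Inverse)

Transduction : ℕ → ℕ → Set₁
Transduction a b = List (Fin a) → List (Fin b) → Set

nth : {A : Set} → List A → ℕ → Maybe A
nth []       _       = nothing
nth (x ∷ xs) zero    = just x
nth (x ∷ xs) (suc i) = nth xs i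

data TSym (a : ℕ) : Set where
  ⊢   : TSym a
  ⊣   : TSym a
  sym : Fin a → TSym a

data Dir : Set where
  -1ᵈ 0ᵈ +1ᵈ : Dir

record Instr (nQ a b : ℕ) : Set where
  field
    p  : Fin nQ
    σ  : TSym a
    q₁ : Fin nQ
    α₁ : List (Fin b)
    ε₁ : Dir
    q₀ : Fin nQ
    α₀ : List (Fin b)
    ε₀ : Dir

record TwoGSM (a b : ℕ) : Set where
  field
    nQ       : ℕ
    δ        : List (Instr nQ a b)
    q-in     : Fin nQ
    q-f      : Fin nQ
    notFinal : All (λ ι → Instr.p ι ≢ q-f) δ

tape : {a : ℕ} → List (Fin a) → ℕ → Maybe (TSym a)
tape w i = nth (⊢ ∷ map sym w ++ [ ⊣ ]) i

move : Dir → ℕ → Maybe ℕ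
move -1ᵈ zero    = nothing
move -1ᵈ (suc i) = just i
move 0ᵈ  i       = just i
move +1ᵈ i       = just (suc i)

-- Run M w q i z ps : there is a computation of M on input w starting in
-- state q at tape position i that reaches q_f, producing output z; ps is
-- the list of tape positions of all configurations of this computation
-- (in order, including the first and the final configuration).
data Run {a b : ℕ} (M : TwoGSM a b) (w : List (Fin a)) :
         Fin (TwoGSM.nQ M) → ℕ → List (Fin b) → List ℕ → Set where
  halt  : ∀ {i} → Run M w (TwoGSM.q-f M) i [] (i ∷ [])
  step₁ : ∀ {ι q i j z ps} → ι ∈ TwoGSM.δ M → Instr.p ι ≡ q →
          tape w i ≡ just (Instr.σ ι) →
          move (Instr.ε₁ ι) i ≡ just j → j ≤ suc (length w) →
          Run M w (Instr.q₁ ι) j z ps →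
          Run M w q i (Instr.α₁ ι ++ z) (i ∷ ps)
  step₀ : ∀ {ι q i j τ z ps} → ι ∈ TwoGSM.δ M → Instr.p ι ≡ q →
          tape w i ≡ just τ → τ ≢ Instr.σ ι →
          move (Instr.ε₀ ι) i ≡ just j → j ≤ suc (length w) →
          Run M w (Instr.q₀ ι) j z ps →
          Run M w q i (Instr.α₀ ι ++ z) (i ∷ ps)

Realized : {a b : ℕ} → TwoGSM a b → List (Fin a) → List (Fin b) → Set
Realized M w z = ∃ λ ps → Run M w (TwoGSM.q-in M) 0 z ps

visits : ℕ → List ℕ → ℕ
visits i ps = length (filter (λ j → j ℕ.≟ i) ps)

KVisiting : ℕ → List ℕ → Set
KVisiting k ps = ∀ i → visits i ps ≤ k

FiniteVisit : {a b : ℕ} → TwoGSM a b → Set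
FiniteVisit M = ∃ λ k → ∀ w z → Realized M w z →
  ∃ λ ps → Run M w (TwoGSM.q-in M) 0 z ps × KVisiting k ps

RealizesT : {a b : ℕ} → TwoGSM a b → Transduction a b → Set
RealizesT M m = ∀ w z → m w z ⇔ Realized M w z

NGSM : {a b : ℕ} → Transduction a b → Set
NGSM m = Σ (TwoGSM _ _) λ M → RealizesT M m

NGSM-fin : {a b : ℕ} → Transduction a b → Set
NGSM-fin m = Σ (TwoGSM _ _) λ M → FiniteVisit M × RealizesT M m

record Graph (S G : ℕ) : Set where
  field
    n    : ℕ
    lab  : Fin n → Fin S
    edge : Fin n → Fin G → Fin n → Bool

-- a graph-like structure with an arbitrary node type (used for the
-- output of an mso transduction); hasLab v σ: v carries label σ
record Structure (S G : ℕ) : Set₁ where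
  field
    V      : Set
    hasLab : V → Fin S → Bool
    edge   : V → Fin G → V → Bool

toStructure : {S G : ℕ} → Graph S G → Structure S G
toStructure g = record
  { V = Fin (Graph.n g)
  ; hasLab = λ u σ → ⌊ Graph.lab g u Fin.≟ σ ⌋
  ; edge = Graph.edge g }

record _≅_ {S G : ℕ} (h : Graph S G) (K : Structure S G) : Set where
  field
    iso     : Fin (Graph.n h) ↔ Structure.V K
  f = Inverse.to iso
  field
    labPres  : ∀ u → Structure.hasLab K (f u) (Graph.lab h u) ≡ true
    edgePres : ∀ u γ v → Graph.edge h u γ v ≡ Structure.edge K (f u) γ (f v)

-- egr(w): unlabelled nodes v₀ … v_k (label alphabet {*} = Fin 1),
-- edges (v_{i-1}, a_i, v_i)
egr : {a : ℕ} → List (Fin a) → Graph 1 a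
egr {a} w = record
  { n = suc (length w)
  ; lab = λ _ → zero
  ; edge = λ u γ v → ⌊ Fin.toℕ v ℕ.≟ suc (Fin.toℕ u) ⌋ ∧ letterIs (nth w (Fin.toℕ u)) γ }
  where
  letterIs : Maybe (Fin a) → Fin a → Bool
  letterIs (just x) γ = ⌊ x Fin.≟ γ ⌋
  letterIs nothing  γ = false

-- MSO logic over graphs with node labels Fin S, edge labels Fin G.
-- Form S G i j: formulas with i free node variables (Fin i) and
-- j free node-set variables (Fin j); quantifiers bind variable zero.

data Form (S G : ℕ) : ℕ → ℕ → Set where
  lab   : ∀ {i j} → Fin S → Fin i → Form S G i j
  edge  : ∀ {i j} → Fin G → Fin i → Fin i → Form S G i j
  eq    : ∀ {i j} → Fin i → Fin i → Form S G i j
  mem   : ∀ {i j} → Fin i → Fin j → Form S G i j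
  neg   : ∀ {i j} → Form S G i j → Form S G i j
  and   : ∀ {i j} → Form S G i j → Form S G i j → Form S G i j
  or    : ∀ {i j} → Form S G i j → Form S G i j → Form S G i j
  ex₁   : ∀ {i j} → Form S G (suc i) j → Form S G i j
  all₁  : ∀ {i j} → Form S G (suc i) j → Form S G i j
  ex₂   : ∀ {i j} → Form S G i (suc j) → Form S G i j
  all₂  : ∀ {i j} → Form S G i (suc j) → Form S G i j

extend : {A : Set} {k : ℕ} → A → (Fin k → A) → Fin (suc k) → A
extend x ρ zero    = x
extend x ρ (suc i) = ρ i

allSubsets : (n : ℕ) → List (Fin n → Bool)
allSubsets zero    = (λ ()) ∷ []
allSubsets (suc n) = concatMap (λ X → extend false X ∷ extend true X ∷ []) (allSubsets n)

-- satisfaction (finite model checking, hence Boolean)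
eval : {S G i j : ℕ} (g : Graph S G) → Form S G i j →
       (Fin i → Fin (Graph.n g)) → (Fin j → Fin (Graph.n g) → Bool) → Bool
eval g (lab σ x)    ρ η = ⌊ Graph.lab g (ρ x) Fin.≟ σ ⌋
eval g (edge γ x y) ρ η = Graph.edge g (ρ x) γ (ρ y)
eval g (eq x y)     ρ η = ⌊ ρ x Fin.≟ ρ y ⌋
eval g (mem x X)    ρ η = η X (ρ x)
eval g (neg φ)      ρ η = not (eval g φ ρ η)
eval g (and φ ψ)    ρ η = eval g φ ρ η ∧ eval g ψ ρ η
eval g (or φ ψ)     ρ η = eval g φ ρ η ∨ eval g ψ ρ η
eval g (ex₁ φ)      ρ η = any (λ u → eval g φ (extend u ρ) η) (allFin (Graph.n g))
eval g (all₁ φ)     ρ η = all (λ u → eval g φ (extend u ρ) η) (allFin (Graph.n g))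
eval g (ex₂ φ)      ρ η = any (λ U → eval g φ ρ (extend U η)) (allSubsets (Graph.n g))
eval g (all₂ φ)     ρ η = all (λ U → eval g φ ρ (extend U η)) (allSubsets (Graph.n g))

-- Nondeterministic mso definable graph transductions from graphs over
-- (S, G) to graphs over (S', G'): k parameters X₁..X_k (set variables
-- Fin k), domain formula, copy set C = Fin nc, node formulas φ^c_σ(x)
-- (node variable zero = x), edge formulas φ^{c₁,c₂}_γ(x,y)
-- (node variable zero = x, suc zero = y).

record MSOT (S G S' G' : ℕ) : Set where
  field
    k     : ℕ
    dom   : Form S G 0 k
    nc    : ℕ
    nodeF : Fin nc → Fin S' → Form S G 1 k
    edgeF : Fin nc → Fin nc → Fin G' → Form S G 2 k

countTrue : {m : ℕ} → (Fin m → Bool) → ℕ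
countTrue {m} f = sum (map (λ σ → if f σ then 1 else 0) (allFin m))

two : {A : Set} → A → A → Fin 2 → A
two x y zero    = x
two x y (suc _) = y

outT : {S G S' G' : ℕ} (Tr : MSOT S G S' G') (g : Graph S G) →
       (Fin (MSOT.k Tr) → Fin (Graph.n g) → Bool) → Structure S' G'
outT {S' = S'} Tr g U = record
  { V = Σ (Fin (Graph.n g) × Fin (MSOT.nc Tr)) (λ uc → T (isNode uc))
  ; hasLab = λ { ((u , c) , _) σ → eval g (MSOT.nodeF Tr c σ) (λ _ → u) U }
  ; edge = λ { ((u , c₁) , _) γ ((v , c₂) , _) → eval g (MSOT.edgeF Tr c₁ c₂ γ) (two u v) U } }
  where
  isNode : Fin (Graph.n g) × Fin (MSOT.nc Tr) → Bool
  isNode (u , c) = ⌊ countTrue (λ σ → eval g (MSOT.nodeF Tr c σ) (λ _ → u) U) ℕ.≟ 1 ⌋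

-- m ∈ NMSO_e: the graph relation {(egr w, egr z) | (w,z) ∈ m} (graphs
-- taken up to isomorphism) is a nondeterministic mso definable graph
-- transduction (input/output graphs: node labels {*} = Fin 1).
NMSO-e : {a b : ℕ} → Transduction a b → Set
NMSO-e {a} {b} m = Σ (MSOT 1 a 1 b) λ Tr →
  ∀ (g : Graph 1 a) (h : Graph 1 b) →
    (Σ (Fin (MSOT.k Tr) → Fin (Graph.n g) → Bool) λ U →
        (eval g (MSOT.dom Tr) (λ ()) U ≡ true) × (h ≅ outT Tr g U))
    ⇔ (∃ λ w → ∃ λ z → m w z × (g ≅ toStructure (egr w)) × (h ≅ toStructure (egr z)))

{-# OPTIONS --safe #-}
module Submission where

-- From NMSO_e to finite visit: an mso transduction bounds the length of the outputs of w, so no loop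
-- of a successful computation on w produces output; cutting the loops leaves a computation that
-- visits each position at most once in each state.
--
-- From finite visit to NMSO_e: split every instruction into steps that write one letter. A
-- computation that visits each position at most K times is then a simple path in a graph with
-- boundedly many copies of each position. The parameters guess the successor of each copy, the domain
-- formula requires that the guess is functional and leads from the start to the final state, and the
-- output string is obtained from the path by contracting the silent steps. Both "reachable" and
-- "reachable by silent steps" are mso definable by quantification over tuples of sets.

open import Defs
open import Data.Nat as ℕ using (ℕ; zero; suc; _+_; _*_; _≤_; _<_; z≤n; s≤s)
import Data.Nat.Properties as ℕₚ
open import Data.Nat.ListAction using (sum)
open import Data.Fin as Fin using (Fin; zero; suc; toℕ; fromℕ<; combine; remQuot; _↑ˡ_; _↑ʳ_)
import Data.Fin.Properties as Finₚ
open import Data.Bool as Bool using (Bool; true; false; not; _∧_; _∨_; T)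
import Data.Bool.Properties as Boolₚ
open import Data.Bool.ListAction as BoolList using (any; all)
open import Data.List
  using (List; []; _∷_; _++_; length; map; drop; lookup; filter; allFin; cartesianProduct)
open import Data.List.Properties
  using (map-cong; ++-assoc; length-++; filter-++; filter-accept; filter-reject)
import Data.List.Relation.Unary.Any as Any
import Data.List.Relation.Unary.Any.Properties as Anyₚ
open import Data.List.Relation.Unary.All as All using (All; []; _∷_)
import Data.List.Relation.Unary.All.Properties as Allₚ
open import Data.List.Relation.Unary.AllPairs using ([]; _∷_)
open import Data.List.Relation.Unary.Unique.Propositional using (Unique)
open import Data.List.Membership.Propositional using (_∈_; find; lose)
open import Data.List.Membership.Propositional.Properties
  using (∈-allFin; ∈-concatMap⁺; ∈-cartesianProduct⁺; ∈-lookup)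
open import Data.Maybe using (Maybe; just; nothing)
import Data.Maybe.Properties as Maybeₚ
open import Data.Product using (Σ; ∃; _×_; _,_; proj₁; proj₂)
open import Data.Product.Properties using (≡-dec)
open import Data.Product.Function.NonDependent.Propositional using (_×-↔_)
open import Data.Sum using (_⊎_; inj₁; inj₂)
open import Data.Sum.Function.Propositional using (_⊎-↔_)
open import Data.Empty using (⊥; ⊥-elim)
open import Data.Unit using (⊤; tt)
open import Function.Base using (_∘_; id)
open import Function.Bundles using (_↔_; _⇔_; mk⇔; mk↔ₛ′; Equivalence; Inverse)
open import Function.Properties.Inverse using (↔⇒↣; ↔-refl; ↔-sym; ↔-trans)
open import Relation.Nullary using (¬_; Dec; yes; no; contradiction)
open import Relation.Nullary.Decidable using (⌊_⌋; _⊎-dec_; _×-dec_; map′; via-injection)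
open import Relation.Binary.Definitions using (DecidableEquality)
open import Relation.Binary.PropositionalEquality
  using (_≡_; _≢_; _≗_; refl; trans; cong; cong₂; subst; subst₂) renaming (sym to ≡-sym)
open import Relation.Binary.Construct.Closure.ReflexiveTransitive using (Star; ε; _◅_; _◅◅_; gmap)
open Equivalence using (to; from)

-- Boolean evaluation of formulas

-- Output edges carry single letters, hence the one-letter steps. Membership in `NMSO-e` speaks of
-- all pairs of graphs, so the domain formula must also reject inputs that are not string graphs:
-- hence `stringF`. A copy consists of a flag, a state of the split machine and a slot. The flag is
-- there because the tape of `w` has `length w + 2` cells while `egr w` has only `length w + 1`
-- nodes. The slot separates visits of one position in the same state, which may continue
-- differently; without it the successor would not be a function. Slots serve completeness, the
-- existence of a correct guess; soundness projects them away, since a functional guess that leads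
-- to the final state is a computation whatever its slots are. The path is simple by determinism: a
-- deterministic path that reaches a vertex without successor cannot revisit a vertex. In the other
-- direction the bound on the output length depends on `w`, but the resulting visit bound is the
-- number of states, the same for all `w`.

infix 3 _⟺_

_⟺_ : Bool → Set → Set
x ⟺ P = (x ≡ true) ⇔ P

⟺-map : ∀ {x P Q} → (P → Q) → (Q → P) → x ⟺ P → x ⟺ Q
⟺-map f g e = mk⇔ (f ∘ to e) (from e ∘ g)

⟺-dec : ∀ {x P} → x ⟺ P → Dec P
⟺-dec {true}  e = yes (to e refl)
⟺-dec {false} e = no λ p → case-false (from e p)
  where
  case-false : false ≡ true → ⊥
  case-false ()

⟺-≡ : ∀ {x y P Q} → x ⟺ P → y ⟺ Q → (P → Q) → (Q → P) → x ≡ y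
⟺-≡ {true}  {y}     e f p q = ≡-sym (from f (p (to e refl)))
⟺-≡ {false} {true}  e f p q = from e (q (to f refl))
⟺-≡ {false} {false} e f p q = refl

∧-⟺ : ∀ {x y P Q} → x ⟺ P → y ⟺ Q → (x ∧ y) ⟺ (P × Q)
∧-⟺ {true}  e f = mk⇔ (λ h → to e refl , to f h) (from f ∘ proj₂)
∧-⟺ {false} e f = mk⇔ (λ ()) (from e ∘ proj₁)

∨-⟺ : ∀ {x y P Q} → x ⟺ P → y ⟺ Q → (x ∨ y) ⟺ (P ⊎ Q)
∨-⟺ {true}  e f = mk⇔ (inj₁ ∘ to e) (λ _ → refl)
∨-⟺ {false} {y} {P} {Q} e f = mk⇔ (inj₂ ∘ to f) back
  where
  back : P ⊎ Q → y ≡ true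
  back (inj₁ p) with () ← from e p
  back (inj₂ q) = from f q

not-⟺ : ∀ {x P} → x ⟺ P → not x ⟺ (¬ P)
not-⟺ {true}  e = mk⇔ (λ ()) (λ ¬p → contradiction (to e refl) ¬p)
not-⟺ {false} e = mk⇔ (λ _ p → contradiction (from e p) λ ()) (λ _ → refl)

⌊⌋-⟺ : ∀ {P} (d : Dec P) → ⌊ d ⌋ ⟺ P
⌊⌋-⟺ (yes p) = mk⇔ (λ _ → p) (λ _ → refl)
⌊⌋-⟺ (no ¬p) = mk⇔ (λ ()) (λ p → contradiction p ¬p)

any-⟺ : ∀ {A : Set} {f : A → Bool} xs → any f xs ⟺ (∃ λ x → x ∈ xs × f x ≡ true)
any-⟺ {f = f} xs = mk⇔
  (λ h → let x , x∈ , t = find (Anyₚ.any⁻ f xs (from Boolₚ.T-≡ h)) in x , x∈ , to Boolₚ.T-≡ t)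
  (λ (x , x∈ , t) → to Boolₚ.T-≡ (Anyₚ.any⁺ f (lose x∈ (from Boolₚ.T-≡ t))))

all-⟺ : ∀ {A : Set} {f : A → Bool} xs → all f xs ⟺ (∀ x → x ∈ xs → f x ≡ true)
all-⟺ {f = f} xs = mk⇔
  (λ h _ x∈ → to Boolₚ.T-≡ (All.lookup (Allₚ.all⁺ f xs (from Boolₚ.T-≡ h)) x∈))
  (λ h → to Boolₚ.T-≡ (Allₚ.all⁻ f {xs} (All.tabulate (λ x∈ → from Boolₚ.T-≡ (h _ x∈)))))

any-allFin-⟺ : ∀ n {f : Fin n → Bool} {P : Fin n → Set} →
  (∀ u → f u ⟺ P u) → any f (allFin n) ⟺ ∃ P
any-allFin-⟺ n e = ⟺-map (λ (u , _ , h) → u , to (e u) h)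
                       (λ (u , p) → u , ∈-allFin u , from (e u) p) (any-⟺ (allFin n))

all-allFin-⟺ : ∀ n {f : Fin n → Bool} {P : Fin n → Set} →
  (∀ u → f u ⟺ P u) → all f (allFin n) ⟺ (∀ u → P u)
all-allFin-⟺ n e = ⟺-map (λ h u → to (e u) (h u (∈-allFin u)))
                       (λ p u _ → from (e u) (p u)) (all-⟺ (allFin n))

extend-cong : ∀ {A B : Set} {k} {x x′ : B → A} {η η′ : Fin k → B → A} →
  x ≗ x′ → (∀ i → η i ≗ η′ i) → ∀ i → extend x η i ≗ extend x′ η′ i
extend-cong p q zero    = p
extend-cong p q (suc i) = q i

-- The enumeration contains each set only up to pointwise equality of characteristic functions.
-- `eval-cong` makes this enough for the set quantifiers.
∈-allSubsets : ∀ n (X : Fin n → Bool) → ∃ λ X′ → X′ ∈ allSubsets n × X′ ≗ X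
∈-allSubsets zero    X = (λ ()) , Any.here refl , λ ()
∈-allSubsets (suc n) X with ∈-allSubsets n (X ∘ suc) | X zero in X₀
... | X′ , X′∈ , p | b = extend b X′ , ∈-concatMap⁺ _ (lose X′∈ (extend∈ b)) , q
  where
  extend∈ : ∀ b → extend b X′ ∈ extend false X′ ∷ extend true X′ ∷ []
  extend∈ false = Any.here refl
  extend∈ true  = Any.there (Any.here refl)
  q : extend b X′ ≗ X
  q zero    = ≡-sym X₀
  q (suc u) = p u

module _ {S G : ℕ} (g : Graph S G) where
  private n = Graph.n g

  eval-cong : ∀ {i j} (φ : Form S G i j) {ρ : Fin i → Fin n} {η η′ : Fin j → Fin n → Bool} →
    (∀ X → η X ≗ η′ X) → eval g φ ρ η ≡ eval g φ ρ η′
  eval-cong (lab σ x)    p = refl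
  eval-cong (edge γ x y) p = refl
  eval-cong (eq x y)     p = refl
  eval-cong (mem x X)    p = p X _
  eval-cong (neg φ)      p = cong not (eval-cong φ p)
  eval-cong (and φ ψ)    p = cong₂ _∧_ (eval-cong φ p) (eval-cong ψ p)
  eval-cong (or φ ψ)     p = cong₂ _∨_ (eval-cong φ p) (eval-cong ψ p)
  eval-cong (ex₁ φ)      p = cong BoolList.or (map-cong (λ u → eval-cong φ p) (allFin n))
  eval-cong (all₁ φ)     p = cong BoolList.and (map-cong (λ u → eval-cong φ p) (allFin n))
  eval-cong (ex₂ φ)      p =
    cong BoolList.or (map-cong (λ U → eval-cong φ (extend-cong (λ _ → refl) p)) (allSubsets n))
  eval-cong (all₂ φ)     p =
    cong BoolList.and (map-cong (λ U → eval-cong φ (extend-cong (λ _ → refl) p)) (allSubsets n))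

  all₂-⟺ : ∀ {i j} (φ : Form S G i (suc j)) {ρ η} {P : (Fin n → Bool) → Set} →
    (∀ U → eval g φ ρ (extend U η) ⟺ P U) → eval g (all₂ φ) ρ η ⟺ (∀ U → P U)
  all₂-⟺ φ {ρ} {η} {P} e = mk⇔ forth (λ p → from (all-⟺ (allSubsets n)) λ U _ → from (e U) (p U))
    where
    forth : eval g (all₂ φ) ρ η ≡ true → ∀ U → P U
    forth h U with ∈-allSubsets n U
    ... | U′ , U′∈ , q = to (e U)
      (trans (≡-sym (eval-cong φ (extend-cong q λ _ _ → refl))) (to (all-⟺ (allSubsets n)) h U′ U′∈))

-- Finite connectives and quantification over tuples of sets

module _ {S G : ℕ} where

  imp : ∀ {i j} → Form S G i j → Form S G i j → Form S G i j
  imp φ ψ = or (neg φ) ψ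

  -- Falsity in a syntax without constants; this form works with no free variable in scope.
  ff : ∀ {i j} → Form S G i j
  ff = ex₁ (neg (eq zero zero))

  -- Conditions on copies and states are decided while the formula is built; only the dependence on
  -- the input graph is left to the logic.
  when : ∀ {i j} {A : Set} → Dec A → Form S G i j → Form S G i j
  when (yes _) φ = φ
  when (no _)  φ = ff

  ⋁ : ∀ {i j m} → (Fin m → Form S G i j) → Form S G i j
  ⋁ {m = zero}  φ = ff
  ⋁ {m = suc m} φ = or (φ zero) (⋁ (φ ∘ suc))

  ⋀ : ∀ {i j m} → (Fin m → Form S G i j) → Form S G i j
  ⋀ {m = zero}  φ = neg ff
  ⋀ {m = suc m} φ = and (φ zero) (⋀ (φ ∘ suc))

  -- A set of vertices of a graph with `m` copies of each node is a tuple of `m` node sets, so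
  -- closure arguments need a whole tuple to be quantified. The new sets come first: `c ↑ˡ j` names
  -- a member of the tuple and `m ↑ʳ p` an older variable.
  alls : ∀ {i j} m → Form S G i (m + j) → Form S G i j
  alls zero    φ = φ
  alls (suc m) φ = alls m (all₂ φ)

extends : ∀ {A : Set} {j} m → (Fin m → A) → (Fin j → A) → Fin (m + j) → A
extends zero    Y η = η
extends (suc m) Y η = extend (Y zero) (extends m (Y ∘ suc) η)

extends-↑ˡ : ∀ {A : Set} {j} m (Y : Fin m → A) (η : Fin j → A) c → extends m Y η (c ↑ˡ j) ≡ Y c
extends-↑ˡ (suc m) Y η zero    = refl
extends-↑ˡ (suc m) Y η (suc c) = extends-↑ˡ m (Y ∘ suc) η c

extends-↑ʳ : ∀ {A : Set} {j} m (Y : Fin m → A) (η : Fin j → A) p → extends m Y η (m ↑ʳ p) ≡ η p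
extends-↑ʳ zero    Y η p = refl
extends-↑ʳ (suc m) Y η p = extends-↑ʳ m (Y ∘ suc) η p

imp-⟺ : ∀ {x y P Q} → x ⟺ P → y ⟺ Q → (not x ∨ y) ⟺ (P → Q)
imp-⟺ {true}  e f = mk⇔ (λ h _ → to f h) (λ k → from f (k (to e refl)))
imp-⟺ {false} e f = mk⇔ (λ _ p → contradiction (from e p) λ ()) (λ _ → refl)

module _ {S G : ℕ} (g : Graph S G) where
  private n = Graph.n g

  ff-⟺ : ∀ {i j} {ρ : Fin i → Fin n} {η : Fin j → Fin n → Bool} → eval g ff ρ η ⟺ ⊥
  ff-⟺ = ⟺-map (λ (u , u≢u) → u≢u refl) ⊥-elim (any-allFin-⟺ n λ u → not-⟺ (⌊⌋-⟺ (u Fin.≟ u)))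

  when-⟺ : ∀ {i j} {A P : Set} (d : Dec A) {φ : Form S G i j} {ρ η} →
    eval g φ ρ η ⟺ P → eval g (when d φ) ρ η ⟺ (A × P)
  when-⟺ (yes a) e = ⟺-map (a ,_) proj₂ e
  when-⟺ (no ¬a) {ρ = ρ} {η} e = ⟺-map ⊥-elim (¬a ∘ proj₁) (ff-⟺ {ρ = ρ} {η})

  ⋁-⟺ : ∀ {i j m} {φ : Fin m → Form S G i j} {ρ η} {P : Fin m → Set} →
    (∀ c → eval g (φ c) ρ η ⟺ P c) → eval g (⋁ φ) ρ η ⟺ ∃ P
  ⋁-⟺ {m = zero}  {ρ = ρ} {η} e = ⟺-map ⊥-elim (λ ()) (ff-⟺ {ρ = ρ} {η})
  ⋁-⟺ {m = suc m} e = ⟺-map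
    (λ { (inj₁ p) → zero , p ; (inj₂ (c , p)) → suc c , p })
    (λ { (zero , p) → inj₁ p ; (suc c , p) → inj₂ (c , p) })
    (∨-⟺ (e zero) (⋁-⟺ (e ∘ suc)))

  ⋀-⟺ : ∀ {i j m} {φ : Fin m → Form S G i j} {ρ η} {P : Fin m → Set} →
    (∀ c → eval g (φ c) ρ η ⟺ P c) → eval g (⋀ φ) ρ η ⟺ (∀ c → P c)
  ⋀-⟺ {m = zero}  {ρ = ρ} {η} e = ⟺-map (λ _ ()) (λ _ ()) (not-⟺ (ff-⟺ {ρ = ρ} {η}))
  ⋀-⟺ {m = suc m} e = ⟺-map
    (λ { (p , q) zero → p ; (p , q) (suc c) → q c })
    (λ p → p zero , p ∘ suc)
    (∧-⟺ (e zero) (⋀-⟺ (e ∘ suc)))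

  alls-⟺ : ∀ {i j} m (φ : Form S G i (m + j)) {ρ η} {P : (Fin m → Fin n → Bool) → Set} →
    (∀ Y → eval g φ ρ (extends m Y η) ⟺ P Y) → eval g (alls m φ) ρ η ⟺ (∀ Y → P Y)
  alls-⟺ zero    φ e = mk⇔ (λ h Y → to (e Y) h) (λ p → from (e λ ()) (p λ ()))
  alls-⟺ (suc m) φ e = ⟺-map
    (λ h Y → to (e Y) (h (Y ∘ suc) (Y zero))) (λ p Y U → from (e (extend U Y)) (p (extend U Y)))
    (alls-⟺ m (all₂ φ) λ Y → all₂-⟺ g φ λ U → mk⇔ id id)

-- Reachability

-- Reachability in a finite graph is decided by the Floyd–Warshall recursion.
module Warshall {V : Set} (_≟_ : DecidableEquality V) {R : V → V → Set} (R? : ∀ x y → Dec (R x y)) where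

  Through : List V → V → V → Set
  Through []       x y = x ≡ y ⊎ R x y
  Through (v ∷ vs) x y = Through vs x y ⊎ (Through vs x v × Through vs v y)

  through? : ∀ vs x y → Dec (Through vs x y)
  through? []       x y = (x ≟ y) ⊎-dec R? x y
  through? (v ∷ vs) x y = through? vs x y ⊎-dec (through? vs x v ×-dec through? vs v y)

  through⇒star : ∀ vs {x y} → Through vs x y → Star R x y
  through⇒star []       (inj₁ refl)    = ε
  through⇒star []       (inj₂ s)       = s ◅ ε
  through⇒star (v ∷ vs) (inj₁ t)       = through⇒star vs t
  through⇒star (v ∷ vs) (inj₂ (t , u)) = through⇒star vs t ◅◅ through⇒star vs u

  through-base : ∀ vs {x y} → x ≡ y ⊎ R x y → Through vs x y
  through-base []       b = b
  through-base (v ∷ vs) b = inj₁ (through-base vs b)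

  -- Concatenation is where the recursion could fail, since a path may pass the pivot `w` more than
  -- once. If both pieces pass `w`, the detour from `w` through `v` back to `w` is dropped; if `v`
  -- is `w` itself, loops at `w` are dropped.
  through-trans : ∀ vs {x v y} → v ∈ vs → Through vs x v → Through vs v y → Through vs x y
  through-trans (w ∷ vs) (Any.here refl) p q = inj₂ (left p , right q)
    where
    left : ∀ {x} → Through (w ∷ vs) x w → Through vs x w
    left (inj₁ t)       = t
    left (inj₂ (t , _)) = t
    right : ∀ {y} → Through (w ∷ vs) w y → Through vs w y
    right (inj₁ t)       = t
    right (inj₂ (_ , t)) = t
  through-trans (w ∷ vs) (Any.there v∈) (inj₁ p)        (inj₁ q)        = inj₁ (through-trans vs v∈ p q)
  through-trans (w ∷ vs) (Any.there v∈) (inj₁ p)        (inj₂ (q , q′)) = inj₂ (through-trans vs v∈ p q , q′)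
  through-trans (w ∷ vs) (Any.there v∈) (inj₂ (p , p′)) (inj₁ q)        = inj₂ (p , through-trans vs v∈ p′ q)
  through-trans (w ∷ vs) (Any.there v∈) (inj₂ (p , p′)) (inj₂ (q , q′)) = inj₂ (p , q′)

  star? : ∀ vs → (∀ v → v ∈ vs) → ∀ x y → Dec (Star R x y)
  star? vs all∈ x y = map′ (through⇒star vs) star⇒through (through? vs x y)
    where
    star⇒through : ∀ {x y} → Star R x y → Through vs x y
    star⇒through ε        = through-base vs (inj₁ refl)
    star⇒through (s ◅ ss) = through-trans vs (all∈ _) (through-base vs (inj₂ s)) (star⇒through ss)

-- The step formula is a function of the renaming `r` that locates the parameters named by `A`,
-- because it is used under `nc` further set quantifiers, which shift these variables.
module Reach {S G nc : ℕ} {A : Set}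
  (stepF : ∀ {i j} → (A → Fin j) → Fin nc → Fin nc → Fin i → Fin i → Form S G i j) where

  closedF : ∀ {i j} → (A → Fin j) → Form S G i (nc + j)
  closedF {j = j} r = ⋀ λ c → ⋀ λ d → all₁ (all₁ (imp
    (and (stepF (λ a → nc ↑ʳ r a) c d (suc zero) zero) (mem (suc zero) (c ↑ˡ j)))
    (mem zero (d ↑ˡ j))))

  -- The reachable vertices form the least family of sets, one per copy, that contains the start and
  -- is closed under steps.
  reachF : ∀ {i j} → (A → Fin j) → Fin nc → Fin nc → Fin i → Fin i → Form S G i j
  reachF {j = j} r c d x y = alls nc (imp (and (mem x (c ↑ˡ j)) (closedF r)) (mem y (d ↑ˡ j)))

  module _ (g : Graph S G) (U : A → Fin (Graph.n g) → Bool)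
    {R : Fin (Graph.n g) × Fin nc → Fin (Graph.n g) × Fin nc → Set}
    (R? : ∀ x y → Dec (R x y))
    (step-⟺ : ∀ {i j} (r : A → Fin j) c d x y (ρ : Fin i → Fin (Graph.n g)) η →
      (∀ a → η (r a) ≗ U a) → eval g (stepF r c d x y) ρ η ⟺ R (ρ x , c) (ρ y , d))
    where

    private
      n = Graph.n g

      Closed : (Fin nc → Fin n → Bool) → Set
      Closed Y = ∀ c d u v → R (u , c) (v , d) × Y c u ≡ true → Y d v ≡ true

      closed-star : ∀ {Y} → Closed Y → ∀ {u c v d} → Star R (u , c) (v , d) → Y c u ≡ true → Y d v ≡ true
      closed-star cl ε        h = h
      closed-star cl (s ◅ ss) h = closed-star cl ss (cl _ _ _ _ (s , h))

      mem-⟺ : ∀ {i j} (Y : Fin nc → Fin n → Bool) (η : Fin j → Fin n → Bool) (ρ : Fin i → Fin n) x c →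
        eval {S} {G} g (mem x (c ↑ˡ j)) ρ (extends nc Y η) ⟺ (Y c (ρ x) ≡ true)
      mem-⟺ Y η ρ x c = mk⇔ (trans (≡-sym e)) (trans e)
        where e = cong (λ X → X (ρ x)) (extends-↑ˡ nc Y η c)

    reach? : ∀ x y → Dec (Star R x y)
    reach? = Warshall.star? (≡-dec Fin._≟_ Fin._≟_) R?
      (cartesianProduct (allFin n) (allFin nc)) λ (u , c) → ∈-cartesianProduct⁺ (∈-allFin u) (∈-allFin c)

    reach-⟺ : ∀ {i j} (r : A → Fin j) c d x y (ρ : Fin i → Fin n) η →
      (∀ a → η (r a) ≗ U a) → eval g (reachF r c d x y) ρ η ⟺ Star R (ρ x , c) (ρ y , d)
    reach-⟺ r c d x y ρ η r≗ = ⟺-map forth back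
      (alls-⟺ g nc (imp (and (mem x (c ↑ˡ _)) (closedF r)) (mem y (d ↑ˡ _))) λ Y →
        imp-⟺ (∧-⟺ (mem-⟺ Y η ρ x c)
          (⋀-⟺ g λ c → ⋀-⟺ g λ d → all-allFin-⟺ n λ u → all-allFin-⟺ n λ v →
            imp-⟺ (∧-⟺ (step-⟺ _ c d (suc zero) zero (extend v (extend u ρ)) (extends nc Y η)
                          λ a w → trans (cong (λ X → X w) (extends-↑ʳ nc Y η (r a))) (r≗ a w))
                        (mem-⟺ Y η (extend v (extend u ρ)) (suc zero) c))
                  (mem-⟺ Y η (extend v (extend u ρ)) zero d)))
          (mem-⟺ Y η ρ y d))
      where
      start : Fin n × Fin nc
      start = ρ x , c
      -- The formula is instantiated with the set of reachable vertices itself. Sets are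
      -- Boolean-valued, so this needs `reach?` and hence the decision procedure.
      Reached : Fin nc → Fin n → Bool
      Reached d v = ⌊ reach? start (v , d) ⌋
      forth : (∀ Y → Y c (ρ x) ≡ true × Closed Y → Y d (ρ y) ≡ true) → Star R start (ρ y , d)
      forth h = to (⌊⌋-⟺ (reach? start _)) (h Reached
        ( from (⌊⌋-⟺ (reach? start _)) ε
        , λ c d u v (s , h) → from (⌊⌋-⟺ (reach? start _)) (to (⌊⌋-⟺ (reach? start _)) h ◅◅ (s ◅ ε))))
      back : Star R start (ρ y , d) → ∀ Y → Y c (ρ x) ≡ true × Closed Y → Y d (ρ y) ≡ true
      back ss Y (h , cl) = closed-star cl ss h

-- Walks and their contraction

data Walk {V O : Set} (R : V → Maybe O → V → Set) : V → V → List O → Set where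
  done   : ∀ {x} → Walk R x x []
  silent : ∀ {x y t z} → R x nothing y → Walk R y t z → Walk R x t z
  loud   : ∀ {x y t z γ} → R x (just γ) y → Walk R y t z → Walk R x t (γ ∷ z)

module _ {V O : Set} {R : V → Maybe O → V → Set} where

  star⇒walk : ∀ {x y} → Star (λ x y → ∃ λ o → R x o y) x y → ∃ λ z → Walk R x y z
  star⇒walk ε                   = [] , done
  star⇒walk ((nothing , s) ◅ ss) = let z , W = star⇒walk ss in z , silent s W
  star⇒walk ((just γ , s) ◅ ss)  = let z , W = star⇒walk ss in γ ∷ z , loud s W

  walk⇒star : ∀ {x y z} → Walk R x y z → Star (λ x y → ∃ λ o → R x o y) x y
  walk⇒star done         = ε
  walk⇒star (silent s W) = (nothing , s) ◅ walk⇒star W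
  walk⇒star (loud s W)   = (just _ , s) ◅ walk⇒star W

-- A deterministic walk from its start to a final vertex, with the silent steps contracted, is a
-- string graph: its nodes are the reachable vertices that emit a letter or are final.
module Contract {V O : Set} (R : V → Maybe O → V → Set) (Out Final : V → Set)
  (det : ∀ {x o y o′ y′} → R x o y → R x o′ y′ → o ≡ o′ × y ≡ y′)
  (stuck : ∀ {x o y} → Final x → ¬ R x o y)
  (out-loud : ∀ {x γ y} → R x (just γ) y → Out x)
  (out-silent : ∀ {x y} → R x nothing y → ¬ Out x)
  (out-final : ∀ {x} → Final x → Out x) where

  Step Silent : V → V → Set
  Step x y   = ∃ λ o → R x o y
  Silent x y = R x nothing y

  Edge : V → O → V → Set
  Edge x γ y = ∃ λ x′ → R x (just γ) x′ × Star Silent x′ y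

  len : ∀ {x t z} → Walk R x t z → ℕ
  len done         = 0
  len (silent _ W) = suc (len W)
  len (loud _ W)   = suc (len W)

  len-unique : ∀ {x t z z′} → Final t → (W : Walk R x t z) (W′ : Walk R x t z′) → len W ≡ len W′
  len-unique F done         done           = refl
  len-unique F done         (silent s _)   = contradiction s (stuck F)
  len-unique F done         (loud s _)     = contradiction s (stuck F)
  len-unique F (silent s _) done           = contradiction s (stuck F)
  len-unique F (loud s _)   done           = contradiction s (stuck F)
  len-unique F (silent s W) (silent s′ W′) with refl , refl ← det s s′ = cong suc (len-unique F W W′)
  len-unique F (loud s W)   (loud s′ W′)   with refl , refl ← det s s′ = cong suc (len-unique F W W′)
  len-unique F (silent s W) (loud s′ W′)   with () , _ ← det s s′
  len-unique F (loud s W)   (silent s′ W′) with () , _ ← det s s′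

  node : ∀ {x t z} → Walk R x t z → Fin (suc (length z)) → V
  node {x} done       _       = x
  node (silent _ W)   i       = node W i
  node {x} (loud _ W) zero    = x
  node (loud _ W)     (suc i) = node W i

  node-reachable : ∀ {x t z} (W : Walk R x t z) i → Star Step x (node W i)
  node-reachable done         i       = ε
  node-reachable (silent s W) i       = (_ , s) ◅ node-reachable W i
  node-reachable (loud s W)   zero    = ε
  node-reachable (loud s W)   (suc i) = (_ , s) ◅ node-reachable W i

  node-out : ∀ {x t z} → Final t → (W : Walk R x t z) → ∀ i → Out (node W i)
  node-out F done         i       = out-final F
  node-out F (silent s W) i       = node-out F W i
  node-out F (loud s W)   zero    = out-loud s
  node-out F (loud s W)   (suc i) = node-out F W i

  node-walk : ∀ {x t z} (W : Walk R x t z) i →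
    ∃ λ z′ → Σ (Walk R (node W i) t z′) λ W′ → len W′ ≤ len W
  node-walk done         i       = [] , done , z≤n
  node-walk (silent s W) i       = let z , W′ , l = node-walk W i in z , W′ , ℕₚ.m≤n⇒m≤1+n l
  node-walk (loud s W)   zero    = _ , loud s W , ℕₚ.≤-refl
  node-walk (loud s W)   (suc i) = let z , W′ , l = node-walk W i in z , W′ , ℕₚ.m≤n⇒m≤1+n l

  -- If `x` recurred, the remaining walk from the second occurrence would be shorter than the one
  -- from the first, contrary to `len-unique`.
  node-≢ : ∀ {x t z γ y} → Final t → R x (just γ) y → (W : Walk R y t z) → ∀ i → node W i ≢ x
  node-≢ F s W i refl = let _ , W′ , l = node-walk W i in
    ℕₚ.1+n≰n (subst (_≤ len W) (len-unique F W′ (loud s W)) l)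

  node-injective : ∀ {x t z} → Final t → (W : Walk R x t z) → ∀ {i j} → node W i ≡ node W j → i ≡ j
  node-injective F done         {zero}  {zero}  e = refl
  node-injective F (silent s W)                 e = node-injective F W e
  node-injective F (loud s W)   {zero}  {zero}  e = refl
  node-injective F (loud s W)   {zero}  {suc j} e = contradiction (≡-sym e) (node-≢ F s W j)
  node-injective F (loud s W)   {suc i} {zero}  e = contradiction e (node-≢ F s W i)
  node-injective F (loud s W)   {suc i} {suc j} e = cong suc (node-injective F W e)

  -- By determinism every path from the start follows `W`, so it cannot reach a vertex off the walk;
  -- and it cannot end inside a silent stretch, because vertices with a silent step are not in
  -- `Out`.
  node-surjective : ∀ {x t z v} → Final t → (W : Walk R x t z) → Star Step x v → Out v →
    ∃ λ i → node W i ≡ v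
  node-surjective F done         ε               o = zero , refl
  node-surjective F done         ((_ , s′) ◅ _)  o = contradiction s′ (stuck F)
  node-surjective F (silent s W) ε               o = contradiction o (out-silent s)
  node-surjective F (silent s W) ((_ , s′) ◅ ss) o with refl , refl ← det s s′ = node-surjective F W ss o
  node-surjective F (loud s W)   ε               o = zero , refl
  node-surjective F (loud s W)   ((_ , s′) ◅ ss) o with refl , refl ← det s s′ =
    let i , e = node-surjective F W ss o in suc i , e

  silent-first : ∀ {x t z} (W : Walk R x t z) → Star Silent x (node W zero)
  silent-first done         = ε
  silent-first (silent s W) = s ◅ silent-first W
  silent-first (loud s W)   = ε

  silent-unique : ∀ {x v v′} → Star Silent x v → Star Silent x v′ → Out v → Out v′ → v ≡ v′
  silent-unique ε        ε          o o′ = refl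
  silent-unique ε        (s′ ◅ _)   o o′ = contradiction o (out-silent s′)
  silent-unique (s ◅ _)  ε          o o′ = contradiction o′ (out-silent s)
  silent-unique (s ◅ ss) (s′ ◅ ss′) o o′ with refl ← proj₂ (det s s′) = silent-unique ss ss′ o o′

  edge-intro : ∀ {x t z γ} (W : Walk R x t z) i j →
    toℕ j ≡ suc (toℕ i) → nth z (toℕ i) ≡ just γ → Edge (node W i) γ (node W j)
  edge-intro done         zero    j             e  ()
  edge-intro (silent s W) i       j             e  l    = edge-intro W i j e l
  edge-intro (loud s W)   zero    (suc zero)    e  refl = _ , s , silent-first W
  edge-intro (loud s W)   zero    (suc (suc _)) () l
  edge-intro (loud s W)   (suc i) (suc j)       e  l    = edge-intro W i j (ℕₚ.suc-injective e) l

  edge-target : ∀ {x t z γ v} → Final t → (W : Walk R x t z) → ∀ i → Edge (node W i) γ v → Out v →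
    nth z (toℕ i) ≡ just γ × ∃ λ j → toℕ j ≡ suc (toℕ i) × node W j ≡ v
  edge-target F done         i       (_ , s′ , _)  o = contradiction s′ (stuck F)
  edge-target F (silent s W) i       e             o = edge-target F W i e o
  edge-target F (loud s W)   zero    (_ , s′ , ss) o with refl , refl ← det s s′ =
    refl , suc zero , refl , silent-unique (silent-first W) ss (node-out F W zero) o
  edge-target F (loud s W)   (suc i) e             o =
    let l , j , p , q = edge-target F W i e o in l , suc j , cong suc p , q

  edge-elim : ∀ {x t z γ} → Final t → (W : Walk R x t z) → ∀ i j → Edge (node W i) γ (node W j) →
    toℕ j ≡ suc (toℕ i) × nth z (toℕ i) ≡ just γ
  edge-elim F W i j e with l , j′ , p , q ← edge-target F W i e (node-out F W j)
    with refl ← node-injective F W q = p , l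

-- String graphs

nth-< : ∀ {A : Set} (xs : List A) {i} → i < length xs → ∃ λ x → nth xs i ≡ just x
nth-< (x ∷ xs) {zero}  _       = x , refl
nth-< (x ∷ xs) {suc i} (s≤s l) = nth-< xs l

nth-just : ∀ {A : Set} (xs : List A) {i x} → nth xs i ≡ just x → i < length xs
nth-just (x ∷ xs) {zero}  _ = s≤s z≤n
nth-just (x ∷ xs) {suc i} e = s≤s (nth-just xs e)

egr-edge-⟺ : ∀ {a} (w : List (Fin a)) u γ v →
  Graph.edge (egr w) u γ v ⟺ (toℕ v ≡ suc (toℕ u) × nth w (toℕ u) ≡ just γ)
egr-edge-⟺ w u γ v with nth w (toℕ u)
... | just x  = ∧-⟺ (⌊⌋-⟺ (toℕ v ℕ.≟ suc (toℕ u))) (⟺-map (cong just) Maybeₚ.just-injective (⌊⌋-⟺ (x Fin.≟ γ)))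
... | nothing = ∧-⟺ (⌊⌋-⟺ (toℕ v ℕ.≟ suc (toℕ u))) (mk⇔ (λ ()) (λ ()))

module StringGraph {a : ℕ} {g : Graph 1 a} {w : List (Fin a)} (iso : g ≅ toStructure (egr w)) where
  open Graph g using (n)

  private
    f : Fin n → Fin (suc (length w))
    f = Inverse.to (_≅_.iso iso)

  pos : Fin n → ℕ
  pos u = toℕ (f u)

  pos≤ : ∀ u → pos u ≤ length w
  pos≤ u = ℕₚ.≤-pred (Finₚ.toℕ<n (f u))

  pos-injective : ∀ {u v} → pos u ≡ pos v → u ≡ v
  pos-injective {u} {v} e = trans (≡-sym (Inverse.strictlyInverseʳ (_≅_.iso iso) u))
    (trans (cong (Inverse.from (_≅_.iso iso)) (Finₚ.toℕ-injective e))
      (Inverse.strictlyInverseʳ (_≅_.iso iso) v))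

  at : ∀ p → p ≤ length w → ∃ λ u → pos u ≡ p
  at p p≤ = Inverse.from (_≅_.iso iso) (fromℕ< (s≤s p≤)) ,
    trans (cong toℕ (Inverse.strictlyInverseˡ (_≅_.iso iso) (fromℕ< (s≤s p≤)))) (Finₚ.toℕ-fromℕ< (s≤s p≤))

  edge-⟺ : ∀ u γ v → Graph.edge g u γ v ⟺ (pos v ≡ suc (pos u) × nth w (pos u) ≡ just γ)
  edge-⟺ u γ v = subst (_⟺ (pos v ≡ suc (pos u) × nth w (pos u) ≡ just γ))
    (≡-sym (_≅_.edgePres iso u γ v)) (egr-edge-⟺ w (f u) γ (f v))

module Stringness {a : ℕ} where

  adjF : ∀ {i j} → Fin i → Fin i → Form 1 a i j
  adjF x y = ⋁ λ γ → edge γ x y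

  open Reach {1} {a} {1} {Fin 0} (λ _ _ _ x y → adjF x y)

  -- The sink makes the walk from the root finite, so neither acyclicity nor injectivity of the edges
  -- has to be required.
  stringF : ∀ {j} → Form 1 a 0 j
  stringF = ex₁ (ex₁ (and
    (and (all₁ (reachF (λ ()) zero zero (suc (suc zero)) zero)) (neg (ex₁ (adjF (suc zero) zero))))
    (all₁ (all₁ (all₁ (⋀ λ γ → ⋀ λ γ′ → imp
      (and (edge γ (suc (suc zero)) (suc zero)) (edge γ′ (suc (suc zero)) zero))
      (when (γ Fin.≟ γ′) (eq (suc zero) zero))))))))

  module _ (g : Graph 1 a) where
    open Graph g using (n)

    Adj : Fin n → Fin n → Set
    Adj u v = ∃ λ γ → Graph.edge g u γ v ≡ true

    adj-⟺ : ∀ {i j} x y (ρ : Fin i → Fin n) (η : Fin j → Fin n → Bool) →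
      eval g (adjF x y) ρ η ⟺ Adj (ρ x) (ρ y)
    adj-⟺ x y ρ η = ⋁-⟺ g {ρ = ρ} {η} λ γ → mk⇔ id id

    private
      R : Fin n × Fin 1 → Fin n × Fin 1 → Set
      R (u , _) (v , _) = Adj u v

      R? : ∀ x y → Dec (R x y)
      R? (u , _) (v , _) = ⟺-dec (adj-⟺ {j = 0} zero (suc zero) (two u v) λ ())

      Functional : Set
      Functional = ∀ u v v′ γ γ′ → Graph.edge g u γ v ≡ true × Graph.edge g u γ′ v′ ≡ true →
        γ ≡ γ′ × v ≡ v′

      IsString : Set
      IsString = ∃ λ r → ∃ λ t →
        ((∀ v → Star R (r , zero) (v , zero)) × ¬ (∃ λ v → Adj t v)) × Functional

      string-⟺′ : ∀ {j} (ρ : Fin 0 → Fin n) (η : Fin j → Fin n → Bool) → eval g stringF ρ η ⟺ IsString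
      string-⟺′ ρ η = any-allFin-⟺ n λ r → any-allFin-⟺ n λ t → ∧-⟺
        (∧-⟺ (all-allFin-⟺ n λ v → reach-⟺ g (λ ()) {R} R? (λ _ _ _ x y ρ η _ → adj-⟺ x y ρ η)
                 (λ ()) zero zero (suc (suc zero)) zero _ η λ ())
              (not-⟺ (any-allFin-⟺ n λ v → adj-⟺ (suc zero) zero _ η)))
        (all-allFin-⟺ n λ u → all-allFin-⟺ n λ v → all-allFin-⟺ n λ v′ →
          ⋀-⟺ g λ γ → ⋀-⟺ g λ γ′ → imp-⟺ (∧-⟺ (mk⇔ id id) (mk⇔ id id))
            (when-⟺ g (γ Fin.≟ γ′) {eq (suc zero) zero}
              {extend v′ (extend v (extend u (extend t (extend r ρ))))} {η} (⌊⌋-⟺ (v Fin.≟ v′))))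

      isString⇒egr : IsString → ∃ λ w → g ≅ toStructure (egr w)
      isString⇒egr (r , t , (reach , sink) , functional) = w , record
        { iso      = mk↔ₛ′ index (node W) (λ i → node-injective final W (proj₂ (surjective (node W i))))
                       (proj₂ ∘ surjective)
        ; labPres  = λ u → lab≡ (Graph.lab g u)
        ; edgePres = λ u γ v → ⟺-≡ (mk⇔ id id) (egr-edge-⟺ w (index u) γ (index v))
            (λ e → edge-elim final W (index u) (index v) (v , subst₂ (λ u v → Graph.edge g u γ v ≡ true)
              (≡-sym (proj₂ (surjective u))) refl e , subst (Star Silent v) (≡-sym (proj₂ (surjective v))) ε))
            (λ (p , q) → subst₂ (λ u v → Graph.edge g u γ v ≡ true)
              (proj₂ (surjective u)) (proj₂ (surjective v))
              (edge-direct (edge-intro W (index u) (index v) p q))) }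
        where
        -- `Contract` is instantiated without silent steps and with every vertex kept, so that the
        -- contracted graph is `g` itself and the walk from root to sink spells `w`.
        E : Fin n → Maybe (Fin a) → Fin n → Set
        E u (just γ) v = Graph.edge g u γ v ≡ true
        E u nothing  v = ⊥

        E-det : ∀ {x o y o′ y′} → E x o y → E x o′ y′ → o ≡ o′ × y ≡ y′
        E-det {o = just γ} {o′ = just γ′} e e′ with refl , refl ← functional _ _ _ _ _ (e , e′) = refl , refl

        E-stuck : ∀ {x o y} → (∀ γ y → Graph.edge g x γ y ≢ true) → ¬ E x o y
        E-stuck {o = just γ} h e = h γ _ e

        open Contract E (λ _ → ⊤) (λ x → ∀ γ y → Graph.edge g x γ y ≢ true)
          (λ {x} {o} {y} {o′} → E-det {x} {o} {y} {o′}) (λ {x} {o} → E-stuck {x} {o})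
          (λ _ → tt) (λ ()) (λ _ → tt)

        steps : ∀ v → Star Step r v
        steps v = gmap proj₁ (λ (γ , e) → just γ , e) (reach v)

        w : List (Fin a)
        w = proj₁ (star⇒walk (steps t))

        W : Walk E r t w
        W = proj₂ (star⇒walk (steps t))

        final : ∀ γ y → Graph.edge g t γ y ≢ true
        final γ y e = sink (y , γ , e)

        surjective : ∀ v → ∃ λ i → node W i ≡ v
        surjective v = node-surjective final W (steps v) tt

        index : Fin n → Fin (suc (length w))
        index v = proj₁ (surjective v)

        edge-direct : ∀ {x γ y} → Edge x γ y → Graph.edge g x γ y ≡ true
        edge-direct (_ , e , ε) = e

        lab≡ : (σ : Fin 1) → Structure.hasLab (toStructure (egr w)) zero σ ≡ true
        lab≡ zero = refl

      egr⇒isString : ∀ {w} → g ≅ toStructure (egr w) → IsString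
      egr⇒isString {w} iso = proj₁ (at 0 z≤n) , proj₁ (at (length w) ℕₚ.≤-refl) ,
        ((λ v → reach _ v refl) , sink) , functional
        where
        open StringGraph {w = w} iso
        reach : ∀ p v → pos v ≡ p → Star R (proj₁ (at 0 z≤n) , zero) (v , zero)
        reach zero v e rewrite pos-injective {proj₁ (at 0 z≤n)} {v}
          (trans (proj₂ (at 0 z≤n)) (≡-sym e)) = ε
        reach (suc p) v e = reach p u q ◅◅
          ((γ , from (edge-⟺ u γ v) (trans e (cong suc (≡-sym q)) , trans (cong (nth w) q) l)) ◅ ε)
          where
          p< : p < length w
          p< = subst (_≤ length w) e (pos≤ v)
          u : Fin n
          u = proj₁ (at p (ℕₚ.<⇒≤ p<))
          q : pos u ≡ p
          q = proj₂ (at p (ℕₚ.<⇒≤ p<))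
          γ : Fin a
          γ = proj₁ (nth-< w p<)
          l : nth w p ≡ just γ
          l = proj₂ (nth-< w p<)
        sink : ¬ (∃ λ v → Adj (proj₁ (at (length w) ℕₚ.≤-refl)) v)
        sink (v , γ , e) = ℕₚ.<-irrefl (proj₂ (at (length w) ℕₚ.≤-refl))
          (nth-just w (proj₂ (to (edge-⟺ _ γ v) e)))
        functional : Functional
        functional u v v′ γ γ′ (e , e′) with p , q ← to (edge-⟺ u γ v) e | p′ , q′ ← to (edge-⟺ u γ′ v′) e′ =
          Maybeₚ.just-injective (trans (≡-sym q) q′) , pos-injective (trans p (≡-sym p′))

    string-⟺ : ∀ {j} (ρ : Fin 0 → Fin n) (η : Fin j → Fin n → Bool) →
      eval g stringF ρ η ⟺ (∃ λ w → g ≅ toStructure (egr w))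
    string-⟺ ρ η = ⟺-map isString⇒egr (λ (w , iso) → egr⇒isString {w} iso) (string-⟺′ ρ η)

-- Splitting instructions into one-letter steps

drop-just : ∀ {A : Set} (xs : List A) {i x} → nth xs i ≡ just x → drop i xs ≡ x ∷ drop (suc i) xs
drop-just (x ∷ xs) {zero}  refl = refl
drop-just (x ∷ xs) {suc i} e    = drop-just xs e

drop-nothing : ∀ {A : Set} (xs : List A) {i} → nth xs i ≡ nothing → drop i xs ≡ []
drop-nothing []       {zero}  e = refl
drop-nothing []       {suc i} e = refl
drop-nothing (x ∷ xs) {suc i} e = drop-nothing xs e

nth-length : ∀ {A : Set} (xs : List A) → nth xs (length xs) ≡ nothing
nth-length []       = refl
nth-length (x ∷ xs) = nth-length xs

≤-sum : ∀ {A : Set} (f : A → ℕ) {x xs} → x ∈ xs → f x ≤ sum (map f xs)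
≤-sum f (Any.here refl) = ℕₚ.m≤m+n _ _
≤-sum f (Any.there x∈)  = ℕₚ.≤-trans (≤-sum f x∈) (ℕₚ.m≤n+m _ _)

visits-∷ : ∀ p i qs → visits p (i ∷ qs) ≡ visits p (i ∷ []) + visits p qs
visits-∷ p i qs = trans (cong length (filter-++ (ℕ._≟ p) (i ∷ []) qs))
  (length-++ (filter (ℕ._≟ p) (i ∷ [])))

visits-self : ∀ i qs → visits i (i ∷ qs) ≡ suc (visits i qs)
visits-self i qs = cong length (filter-accept (ℕ._≟ i) refl)

visits-mono : ∀ p i qs → visits p qs ≤ visits p (i ∷ qs)
visits-mono p i qs = subst (visits p qs ≤_) (≡-sym (visits-∷ p i qs)) (ℕₚ.m≤n+m _ _)

module Micro {a b : ℕ} (M : TwoGSM a b) where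
  open TwoGSM M

  -- An instruction together with the outcome of its test, so that target, output and move become
  -- functions of the rule.
  Rule : Set
  Rule = Fin (length δ) × Bool

  src : Rule → Fin nQ
  src (ι , _) = Instr.p (lookup δ ι)

  dst : Rule → Fin nQ
  dst (ι , true)  = Instr.q₁ (lookup δ ι)
  dst (ι , false) = Instr.q₀ (lookup δ ι)

  α : Rule → List (Fin b)
  α (ι , true)  = Instr.α₁ (lookup δ ι)
  α (ι , false) = Instr.α₀ (lookup δ ι)

  dir : Rule → Dir
  dir (ι , true)  = Instr.ε₁ (lookup δ ι)
  dir (ι , false) = Instr.ε₀ (lookup δ ι)

  Guard : Rule → Maybe (TSym a) → Set
  Guard (ι , true)  t = t ≡ just (Instr.σ (lookup δ ι))
  Guard (ι , false) t = ∃ λ τ → t ≡ just τ × τ ≢ Instr.σ (lookup δ ι)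

  output-length : Instr nQ a b → ℕ
  output-length ι = length (Instr.α₁ ι) + length (Instr.α₀ ι)

  -- A crude common bound on the outputs of single rules. It keeps the number of letters already
  -- written, and thereby `S`, finite.
  bound : ℕ
  bound = sum (map output-length δ)

  α≤bound : ∀ ρ → length (α ρ) ≤ bound
  α≤bound (ι , true)  = ℕₚ.≤-trans (ℕₚ.m≤m+n _ _) (≤-sum output-length (∈-lookup {xs = δ} ι))
  α≤bound (ι , false) = ℕₚ.≤-trans (ℕₚ.m≤n+m _ _) (≤-sum output-length (∈-lookup {xs = δ} ι))

  S : Set
  S = Fin nQ ⊎ (Rule × Fin (suc bound))

  emission : S → Maybe (Fin b)
  emission (inj₁ q)       = nothing
  emission (inj₂ (ρ , t)) = nth (α ρ) (toℕ t)

  module _ (w : List (Fin a)) where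

    -- In state (ρ , t) the first t letters of the output of ρ have been written.
    data Link : S × ℕ → Maybe (Fin b) → S × ℕ → Set where
      choose : ∀ {q ρ i} → src ρ ≡ q → Guard ρ (tape w i) →
        Link (inj₁ q , i) nothing (inj₂ (ρ , zero) , i)
      write  : ∀ {ρ t t′ i γ} → nth (α ρ) (toℕ t) ≡ just γ → toℕ t′ ≡ suc (toℕ t) →
        Link (inj₂ (ρ , t) , i) (just γ) (inj₂ (ρ , t′) , i)
      leave  : ∀ {ρ t i j q} → nth (α ρ) (toℕ t) ≡ nothing → dst ρ ≡ q →
        move (dir ρ) i ≡ just j → j ≤ suc (length w) →
        Link (inj₂ (ρ , t) , i) nothing (inj₁ q , j)

    -- The source state alone determines what a step emits. Hence silence can be decided while a
    -- formula is built, and this is one part of determinism.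
    link-emission : ∀ {s i o y} → Link (s , i) o y → o ≡ emission s
    link-emission (choose _ _)    = refl
    link-emission (write e _)     = ≡-sym e
    link-emission (leave e _ _ _) = ≡-sym e

    link-≢-final : ∀ {i o y} → ¬ Link (inj₁ q-f , i) o y
    link-≢-final (choose {ρ = ι , br} e _) = All.lookup notFinal (∈-lookup ι) e

    link-bounded : ∀ {s i o s′ j} → i ≤ suc (length w) → Link (s , i) o (s′ , j) → j ≤ suc (length w)
    link-bounded i≤ (choose _ _)     = i≤
    link-bounded i≤ (write _ _)      = i≤
    link-bounded i≤ (leave _ _ _ j≤) = j≤

    rule-step : ∀ ρ {i j z ps} → Guard ρ (tape w i) → move (dir ρ) i ≡ just j → j ≤ suc (length w) →
      Run M w (dst ρ) j z ps → Run M w (src ρ) i (α ρ ++ z) (i ∷ ps)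
    rule-step (ι , true)  g             m l r = step₁ (∈-lookup ι) refl g m l r
    rule-step (ι , false) (τ , e , τ≢σ) m l r = step₀ (∈-lookup ι) refl e τ≢σ m l r

    mutual
      walk⇒run : ∀ {q i j z} → Walk Link (inj₁ q , i) (inj₁ q-f , j) z → ∃ λ ps → Run M w q i z ps
      walk⇒run done = _ , halt
      walk⇒run (silent (choose {ρ = ρ} refl g) W)
        with j , z′ , ps , m , l , r , refl ← emitting⇒run W = _ , rule-step ρ g m l r

      -- The walk may start in the middle of an output, so only the letters after the first `t` are
      -- accounted for. The caller has `t` equal to `zero` and recovers all of `α ρ`.
      emitting⇒run : ∀ {ρ t i j z} → Walk Link (inj₂ (ρ , t) , i) (inj₁ q-f , j) z →
        ∃ λ j → ∃ λ z′ → ∃ λ ps → move (dir ρ) i ≡ just j × j ≤ suc (length w) ×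
          Run M w (dst ρ) j z′ ps × z ≡ drop (toℕ t) (α ρ) ++ z′
      emitting⇒run {ρ} {t} (loud (write e t≡) W)
        with j , z′ , ps , m , l , r , refl ← emitting⇒run W =
          j , z′ , ps , m , l , r , cong (_++ z′)
            (trans (cong (_ ∷_) (cong (λ t → drop t (α ρ)) t≡)) (≡-sym (drop-just (α ρ) e)))
      emitting⇒run {ρ} (silent (leave e refl m l) W) with ps , r ← walk⇒run W =
        _ , _ , ps , m , l , r , cong (_++ _) (≡-sym (drop-nothing (α ρ) e))

    positions : ∀ {x t z} → Walk Link x t z → List ℕ
    positions {_ , i} done         = i ∷ []
    positions {_ , i} (silent _ W) = i ∷ positions W
    positions {_ , i} (loud _ W)   = i ∷ positions W

    -- Induction on the number `m` of letters still to be written. The walk stays at `i` for `m`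
    -- writing steps and one leaving step, which gives the factor `suc m`.
    emit-walk : ∀ m ρ t {i j q z} → toℕ t + m ≡ length (α ρ) → move (dir ρ) i ≡ just j → j ≤ suc (length w) →
      (W : Walk Link (inj₁ (dst ρ) , j) (inj₁ q-f , q) z) →
      Σ (Walk Link (inj₂ (ρ , t) , i) (inj₁ q-f , q) (drop (toℕ t) (α ρ) ++ z)) λ W′ →
        ∀ p → visits p (positions W′) ≡ visits p (i ∷ []) * suc m + visits p (positions W)
    emit-walk zero ρ t {i} {z = z} e mv l W =
      subst (λ xs → Σ (Walk Link (inj₂ (ρ , t) , i) _ (xs ++ z)) λ W′ →
          ∀ p → visits p (positions W′) ≡ visits p (i ∷ []) * 1 + visits p (positions W))
        (≡-sym (drop-nothing (α ρ) end))
        (silent (leave end refl mv l) W , λ p → trans (visits-∷ p i _)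
          (cong (_+ visits p (positions W)) (≡-sym (ℕₚ.*-identityʳ _))))
      where
      end : nth (α ρ) (toℕ t) ≡ nothing
      end = trans (cong (nth (α ρ)) (trans (≡-sym (ℕₚ.+-identityʳ _)) e)) (nth-length (α ρ))
    emit-walk (suc m) ρ t {i} {z = z} e mv l W =
      subst (λ xs → Σ (Walk Link (inj₂ (ρ , t) , i) _ (xs ++ z)) λ W′ →
          ∀ p → visits p (positions W′) ≡ visits p (i ∷ []) * suc (suc m) + visits p (positions W))
        (≡-sym (trans (drop-just (α ρ) γ≡) (cong (λ k → proj₁ (nth-< (α ρ) t<) ∷ drop k (α ρ)) (≡-sym t′≡))))
        (loud (write γ≡ t′≡) W′ , λ p → trans (visits-∷ p i _)
          (trans (cong (visits p (i ∷ []) +_) (count p))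
            (trans (≡-sym (ℕₚ.+-assoc (visits p (i ∷ [])) _ _))
              (cong (_+ visits p (positions W)) (≡-sym (ℕₚ.*-suc (visits p (i ∷ [])) (suc m)))))))
      where
      t< : toℕ t < length (α ρ)
      t< = subst (toℕ t <_) e (ℕₚ.m<m+n _ (s≤s z≤n))
      γ≡ : nth (α ρ) (toℕ t) ≡ just (proj₁ (nth-< (α ρ) t<))
      γ≡ = proj₂ (nth-< (α ρ) t<)
      t′ : Fin (suc bound)
      t′ = fromℕ< (s≤s (ℕₚ.≤-trans t< (α≤bound ρ)))
      t′≡ : toℕ t′ ≡ suc (toℕ t)
      t′≡ = Finₚ.toℕ-fromℕ< (s≤s (ℕₚ.≤-trans t< (α≤bound ρ)))
      IH : _
      IH = emit-walk m ρ t′ {i} (trans (cong (_+ m) t′≡) (trans (≡-sym (ℕₚ.+-suc (toℕ t) m)) e)) mv l W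
      W′ : Walk Link (inj₂ (ρ , t′) , i) _ _
      W′ = proj₁ IH
      count : ∀ p → visits p (positions W′) ≡ visits p (i ∷ []) * suc m + visits p (positions W)
      count = proj₂ IH

    -- A configuration of the run becomes the vertex of its state followed by one vertex for each
    -- number of letters written, from 0 to the length of the output: at most `2 + bound` vertices
    -- at the same position.
    Simulates : Fin nQ → ℕ → List (Fin b) → List ℕ → Set
    Simulates q i z ps = ∃ λ j → Σ (Walk Link (inj₁ q , i) (inj₁ q-f , j) z) λ W →
      ∀ p → visits p (positions W) ≤ visits p ps * (2 + bound)

    simulate-rule : ∀ ρ {i j z ps} → Guard ρ (tape w i) → move (dir ρ) i ≡ just j → j ≤ suc (length w) →
      Simulates (dst ρ) j z ps → Simulates (src ρ) i (α ρ ++ z) (i ∷ ps)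
    simulate-rule ρ {i} {ps = ps} g mv l (t , W , count)
      with W′ , count′ ← emit-walk (length (α ρ)) ρ zero {i} refl mv l W =
      t , silent (choose refl g) W′ , λ p → let v = visits p (i ∷ []) in begin
        visits p (i ∷ positions W′)                         ≡⟨ visits-∷ p i (positions W′) ⟩
        v + visits p (positions W′)                         ≡⟨ cong (v +_) (count′ p) ⟩
        v + (v * suc (length (α ρ)) + visits p (positions W)) ≡⟨ ≡-sym (ℕₚ.+-assoc v _ _) ⟩
        (v + v * suc (length (α ρ))) + visits p (positions W)
          ≡⟨ cong (_+ visits p (positions W)) (≡-sym (ℕₚ.*-suc v _)) ⟩
        v * (2 + length (α ρ)) + visits p (positions W)
          ≤⟨ ℕₚ.+-mono-≤ (ℕₚ.*-monoʳ-≤ v (s≤s (s≤s (α≤bound ρ)))) (count p) ⟩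
        v * (2 + bound) + visits p ps * (2 + bound)         ≡⟨ ≡-sym (ℕₚ.*-distribʳ-+ (2 + bound) v _) ⟩
        (v + visits p ps) * (2 + bound)                     ≡⟨ cong (_* (2 + bound)) (≡-sym (visits-∷ p i ps)) ⟩
        visits p (i ∷ ps) * (2 + bound)                     ∎
      where open ℕₚ.≤-Reasoning

    run⇒walk : ∀ {q i z ps} → Run M w q i z ps → Simulates q i z ps
    run⇒walk halt = _ , done , λ p → ℕₚ.m≤m*n _ (2 + bound)
    run⇒walk (step₁ ι∈ refl g mv l r) = simulate₁ (Any.index ι∈) (Anyₚ.lookup-index ι∈) g mv l (run⇒walk r)
      where
      simulate₁ : ∀ k {ι i j z ps} → ι ≡ lookup δ k → tape w i ≡ just (Instr.σ ι) →
        move (Instr.ε₁ ι) i ≡ just j → j ≤ suc (length w) →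
        Simulates (Instr.q₁ ι) j z ps → Simulates (Instr.p ι) i (Instr.α₁ ι ++ z) (i ∷ ps)
      simulate₁ k refl = simulate-rule (k , true)
    run⇒walk (step₀ ι∈ refl e τ≢σ mv l r) =
      simulate₀ (Any.index ι∈) (Anyₚ.lookup-index ι∈) (_ , e , τ≢σ) mv l (run⇒walk r)
      where
      simulate₀ : ∀ k {ι i j z ps} → ι ≡ lookup δ k → (∃ λ τ → tape w i ≡ just τ × τ ≢ Instr.σ ι) →
        move (Instr.ε₀ ι) i ≡ just j → j ≤ suc (length w) →
        Simulates (Instr.q₀ ι) j z ps → Simulates (Instr.p ι) i (Instr.α₀ ι ++ z) (i ∷ ps)
      simulate₀ k refl = simulate-rule (k , false)

    -- A vertex carries a slot: the number of remaining visits of its position, and 0 at the start.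
    slot : ∀ {x t z} → Walk Link x t z → ℕ
    slot {_ , i} W = visits i (positions W)

    -- The successor relation that the parameters will encode. The slot `k` of the first vertex is
    -- an argument because the start gets slot 0, which makes its copy independent of the
    -- computation.
    pairs : ∀ {x t z} → Walk Link x t z → ℕ → List (((S × ℕ) × ℕ) × ((S × ℕ) × ℕ))
    pairs done                   k = []
    pairs {x} (silent {y = y} _ W) k = ((x , k) , (y , slot W)) ∷ pairs W (slot W)
    pairs {x} (loud {y = y} _ W)   k = ((x , k) , (y , slot W)) ∷ pairs W (slot W)

    source-slot : ∀ {x t z} (W : Walk Link x t z) {y k v} → ((y , k) , v) ∈ pairs W (slot W) →
      1 ≤ k × k ≤ visits (proj₂ y) (positions W)
    source-slot {_ , i} (silent s W) (Any.here refl) =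
      subst (1 ≤_) (≡-sym (visits-self i _)) (s≤s z≤n) , ℕₚ.≤-refl
    source-slot {_ , i} (loud s W)   (Any.here refl) =
      subst (1 ≤_) (≡-sym (visits-self i _)) (s≤s z≤n) , ℕₚ.≤-refl
    source-slot {_ , i} (silent s W) {y} (Any.there e) =
      let p , q = source-slot W e in p , ℕₚ.≤-trans q (visits-mono (proj₂ y) i (positions W))
    source-slot {_ , i} (loud s W)   {y} (Any.there e) =
      let p , q = source-slot W e in p , ℕₚ.≤-trans q (visits-mono (proj₂ y) i (positions W))

    Fresh : ∀ {x t z} → Walk Link x t z → ℕ → Set
    Fresh W k = k ≡ 0 ⊎ k ≡ slot W

    head-fresh : ∀ {i k s′ y t z v} (W : Walk Link y t z) → k ≡ 0 ⊎ k ≡ visits i (i ∷ positions W) →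
      ¬ (((s′ , i) , k) , v) ∈ pairs W (slot W)
    head-fresh W (inj₁ refl) e with () ← proj₁ (source-slot W e)
    head-fresh {i} W (inj₂ refl) e =
      ℕₚ.1+n≰n (subst (_≤ visits i (positions W)) (visits-self i (positions W)) (proj₂ (source-slot W e)))

    -- Along the walk the slots of a fixed position strictly decrease and stay positive, while the
    -- start has slot 0. So no position is left twice with the same slot, even if the machine
    -- repeats a state there.
    pairs-functional : ∀ {x t z} (W : Walk Link x t z) {k} → Fresh W k →
      ∀ {y v v′} → (y , v) ∈ pairs W k → (y , v′) ∈ pairs W k → v ≡ v′
    pairs-functional (silent s W) f (Any.here refl) (Any.here refl) = refl
    pairs-functional (loud s W)   f (Any.here refl) (Any.here refl) = refl
    pairs-functional (silent s W) f (Any.here refl) (Any.there e)   = contradiction e (head-fresh W f)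
    pairs-functional (loud s W)   f (Any.here refl) (Any.there e)   = contradiction e (head-fresh W f)
    pairs-functional (silent s W) f (Any.there e)   (Any.here refl) = contradiction e (head-fresh W f)
    pairs-functional (loud s W)   f (Any.there e)   (Any.here refl) = contradiction e (head-fresh W f)
    pairs-functional (silent s W) f (Any.there e)   (Any.there e′)  = pairs-functional W (inj₂ refl) e e′
    pairs-functional (loud s W)   f (Any.there e)   (Any.there e′)  = pairs-functional W (inj₂ refl) e e′

-- Tape positions in mso logic

-- The tape has one position more than the graph has nodes: the pair of the node x and the flag f
-- stands for the position of x plus f.
offset : Bool → ℕ → ℕ
offset false p = p
offset true  p = suc p

module _ {a : ℕ} where

  tape-sym-⇔ : ∀ (w : List (Fin a)) i {x} → tape w (suc i) ≡ just (sym x) ⇔ nth w i ≡ just x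
  tape-sym-⇔ []      zero    = mk⇔ (λ ()) (λ ())
  tape-sym-⇔ []      (suc i) = mk⇔ (λ ()) (λ ())
  tape-sym-⇔ (y ∷ w) zero    = mk⇔ (λ { refl → refl }) (λ { refl → refl })
  tape-sym-⇔ (y ∷ w) (suc i) = tape-sym-⇔ w i

  tape-⊣-⇔ : ∀ (w : List (Fin a)) i → tape w (suc i) ≡ just ⊣ ⇔ i ≡ length w
  tape-⊣-⇔ []      zero    = mk⇔ (λ _ → refl) (λ _ → refl)
  tape-⊣-⇔ []      (suc i) = mk⇔ (λ ()) (λ ())
  tape-⊣-⇔ (y ∷ w) zero    = mk⇔ (λ ()) (λ ())
  tape-⊣-⇔ (y ∷ w) (suc i) =
    mk⇔ (cong suc ∘ to (tape-⊣-⇔ w i)) (from (tape-⊣-⇔ w i) ∘ ℕₚ.suc-injective)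

  tape-⊢ : ∀ (w : List (Fin a)) i → tape w i ≡ just ⊢ → i ≡ 0
  tape-⊢ w       zero          e = refl
  tape-⊢ (y ∷ w) (suc (suc i)) e with () ← tape-⊢ w (suc i) e
  tape-⊢ []      (suc zero)    ()
  tape-⊢ []      (suc (suc i)) ()

  tape-defined : ∀ (w : List (Fin a)) i → i ≤ suc (length w) → ∃ λ τ → tape w i ≡ just τ
  tape-defined w       zero          _       = ⊢ , refl
  tape-defined []      (suc zero)    _       = ⊣ , refl
  tape-defined []      (suc (suc i)) (s≤s ())
  tape-defined (y ∷ w) (suc zero)    _       = sym y , refl
  tape-defined (y ∷ w) (suc (suc i)) (s≤s l) = tape-defined w (suc i) l

  private
    F : ℕ → ℕ → Set
    F = Form 1 a

  open Stringness {a} using (adjF; Adj; adj-⟺)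

  -- A tape cell can have two representations: a node with flag `true`, or the following node with
  -- flag `false`. With different flags, equality of cells is therefore adjacency of nodes.
  sameF : ∀ {i j} → Bool → Bool → Fin i → Fin i → F i j
  sameF false false x y = eq x y
  sameF true  true  x y = eq x y
  sameF false true  x y = adjF y x
  sameF true  false x y = adjF x y

  nextF : ∀ {i j} → Bool → Bool → Fin i → Fin i → F i j
  nextF false false x y = adjF x y
  nextF true  true  x y = adjF x y
  nextF false true  x y = eq x y
  nextF true  false x y = ex₁ (and (adjF (suc x) zero) (adjF zero (suc y)))

  moveF : ∀ {i j} → Dir → Bool → Bool → Fin i → Fin i → F i j
  moveF -1ᵈ f f′ x y = nextF f′ f y x
  moveF 0ᵈ  f f′ x y = sameF f f′ x y
  moveF +1ᵈ f f′ x y = nextF f f′ x y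

  firstF : ∀ {i j} → Fin i → F i j
  firstF x = neg (ex₁ (adjF zero (suc x)))

  -- Cell 0 holds the left marker, and cell `suc i` holds the letter on the edge that leaves the
  -- node at position `i`. So a letter is read from the incoming edge without the flag and from the
  -- outgoing edge with it; the right marker is seen with the flag at the last node.
  symbolF : ∀ {i j} → TSym a → Bool → Fin i → F i j
  symbolF ⊢       false x = firstF x
  symbolF ⊢       true  x = ff
  symbolF ⊣       false x = ff
  symbolF ⊣       true  x = neg (ex₁ (adjF (suc x) zero))
  symbolF (sym σ) false x = ex₁ (edge σ zero (suc x))
  symbolF (sym σ) true  x = ex₁ (edge σ (suc x) zero)

  module TapeFormulas {g : Graph 1 a} {w : List (Fin a)} (iso : g ≅ toStructure (egr w)) where
    open Graph g using (n)
    open StringGraph {a} {g} {w} iso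

    P : Fin n → Bool → ℕ
    P u f = offset f (pos u)

    P≤ : ∀ u f → P u f ≤ suc (length w)
    P≤ u false = ℕₚ.m≤n⇒m≤1+n (pos≤ u)
    P≤ u true  = s≤s (pos≤ u)

    P-injective : ∀ f {u v} → P u f ≡ P v f → u ≡ v
    P-injective false e = pos-injective e
    P-injective true  e = pos-injective (ℕₚ.suc-injective e)

    adj⇒pos : ∀ {u v} → Adj g u v → pos v ≡ suc (pos u)
    adj⇒pos {u} {v} (γ , e) = proj₁ (to (edge-⟺ u γ v) e)

    pos⇒adj : ∀ {u v} → pos v ≡ suc (pos u) → Adj g u v
    pos⇒adj {u} {v} e with γ , l ← nth-< w (subst (_≤ length w) e (pos≤ v)) = γ , from (edge-⟺ u γ v) (e , l)

    module _ {i j : ℕ} {ρ : Fin i → Fin n} {η : Fin j → Fin n → Bool} where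

      eq-⟺ : ∀ x y → eval g (eq x y) ρ η ⟺ (pos (ρ x) ≡ pos (ρ y))
      eq-⟺ x y = ⟺-map (cong pos) pos-injective (⌊⌋-⟺ (ρ x Fin.≟ ρ y))

      adjacent-⟺ : ∀ x y → eval g (adjF x y) ρ η ⟺ (pos (ρ y) ≡ suc (pos (ρ x)))
      adjacent-⟺ x y = ⟺-map adj⇒pos pos⇒adj (adj-⟺ g x y ρ η)

      same-⟺ : ∀ f f′ x y → eval g (sameF f f′ x y) ρ η ⟺ (P (ρ x) f ≡ P (ρ y) f′)
      same-⟺ false false x y = eq-⟺ x y
      same-⟺ true  true  x y = ⟺-map (cong suc) ℕₚ.suc-injective (eq-⟺ x y)
      same-⟺ false true  x y = adjacent-⟺ y x
      same-⟺ true  false x y = ⟺-map ≡-sym ≡-sym (adjacent-⟺ x y)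

    module _ {i j : ℕ} {ρ : Fin i → Fin n} {η : Fin j → Fin n → Bool} where

      next-⟺ : ∀ f f′ x y → eval g (nextF f f′ x y) ρ η ⟺ (P (ρ y) f′ ≡ suc (P (ρ x) f))
      next-⟺ false false x y = adjacent-⟺ x y
      next-⟺ true  true  x y = ⟺-map (cong suc) ℕₚ.suc-injective (adjacent-⟺ x y)
      next-⟺ false true  x y = ⟺-map (cong suc ∘ ≡-sym) (≡-sym ∘ ℕₚ.suc-injective) (eq-⟺ {η = η} x y)
      next-⟺ true  false x y = ⟺-map
        (λ (v , p , q) → trans q (cong suc p))
        (λ e → let v , p = at (suc (pos (ρ x))) (ℕₚ.<⇒≤ (subst (_≤ length w) e (pos≤ (ρ y)))) in
          v , p , trans e (cong suc (≡-sym p)))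
        (any-allFin-⟺ n λ v → ∧-⟺ (adjacent-⟺ (suc x) zero) (adjacent-⟺ zero (suc y)))

      first-⟺ : ∀ x → eval g (firstF x) ρ η ⟺ (pos (ρ x) ≡ 0)
      first-⟺ x = ⟺-map forth (λ e (v , p) → case-0 (trans (≡-sym e) p))
        (not-⟺ (any-allFin-⟺ n λ v → adjacent-⟺ zero (suc x)))
        where
        case-0 : ∀ {m} → 0 ≢ suc m
        case-0 ()
        forth : ¬ (∃ λ v → pos (ρ x) ≡ suc (pos v)) → pos (ρ x) ≡ 0
        forth h with pos (ρ x) in e
        ... | zero  = refl
        ... | suc p = contradiction (cong suc (≡-sym (proj₂ (at p p≤)))) (λ q → h (_ , q))
          where p≤ = ℕₚ.<⇒≤ (subst (_≤ length w) e (pos≤ (ρ x)))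

    module _ {i j : ℕ} {ρ : Fin i → Fin n} {η : Fin j → Fin n → Bool} where

      move-⟺ : ∀ d f f′ x y → eval g (moveF d f f′ x y) ρ η ⟺ (move d (P (ρ x) f) ≡ just (P (ρ y) f′))
      move-⟺ 0ᵈ  f f′ x y = ⟺-map (cong just) Maybeₚ.just-injective (same-⟺ f f′ x y)
      move-⟺ +1ᵈ f f′ x y = ⟺-map (cong just ∘ ≡-sym) (≡-sym ∘ Maybeₚ.just-injective) (next-⟺ f f′ x y)
      move-⟺ -1ᵈ f f′ x y = ⟺-map (λ e → cong (move -1ᵈ) e) back (next-⟺ f′ f y x)
        where
        back : ∀ {p q} → move -1ᵈ p ≡ just q → p ≡ suc q
        back {suc p} refl = refl

      symbol-⟺ : ∀ τ f x → eval g (symbolF τ f x) ρ η ⟺ (tape w (P (ρ x) f) ≡ just τ)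
      symbol-⟺ ⊢ false x = ⟺-map (λ e → cong (tape w) e) (tape-⊢ w _) (first-⟺ x)
      symbol-⟺ ⊢ true  x = ⟺-map ⊥-elim (λ e → contradiction (tape-⊢ w (suc (pos (ρ x))) e) λ ()) (ff-⟺ g {ρ = ρ} {η})
      symbol-⟺ ⊣ false x = ⟺-map ⊥-elim (absurd (pos≤ (ρ x))) (ff-⟺ g {ρ = ρ} {η})
        where
        absurd : ∀ {p} → p ≤ length w → tape w p ≢ just ⊣
        absurd {suc p} l e = ℕₚ.<-irrefl (to (tape-⊣-⇔ w p) e) l
      symbol-⟺ ⊣ true  x = ⟺-map
        (λ h → from (tape-⊣-⇔ w _) (ℕₚ.≤-antisym (pos≤ (ρ x)) (ℕₚ.≮⇒≥ λ l → h (at _ l))))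
        (λ e (v , p) → ℕₚ.1+n≰n (subst (λ m → m ≤ length w) (trans p (cong suc (to (tape-⊣-⇔ w _) e))) (pos≤ v)))
        (not-⟺ (any-allFin-⟺ n λ v → adjacent-⟺ (suc x) zero))
      symbol-⟺ (sym σ) false x = ⟺-map
        (λ (v , p , l) → subst (λ m → tape w m ≡ just (sym σ)) (≡-sym p) (from (tape-sym-⇔ w (pos v)) l))
        back
        (any-allFin-⟺ n λ v → edge-⟺ v σ (ρ x))
        where
        back : tape w (pos (ρ x)) ≡ just (sym σ) → ∃ λ v → pos (ρ x) ≡ suc (pos v) × nth w (pos v) ≡ just σ
        back e with pos (ρ x) in q
        ... | suc p with v , refl ← at p (ℕₚ.<⇒≤ (subst (_≤ length w) q (pos≤ (ρ x)))) =
          v , refl , to (tape-sym-⇔ w _) e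
      symbol-⟺ (sym σ) true x = ⟺-map
        (λ (v , p , l) → from (tape-sym-⇔ w _) l)
        (λ e → let l = to (tape-sym-⇔ w _) e ; v , p = at _ (nth-just w l) in v , p , l)
        (any-allFin-⟺ n λ v → edge-⟺ (ρ x) σ v)

-- The mso transduction of a 2gsm

nothing? : ∀ {A : Set} (x : Maybe A) → Dec (x ≡ nothing)
nothing? nothing  = yes refl
nothing? (just _) = no λ ()

just? : ∀ {A : Set} (x : Maybe A) → Dec (∃ λ y → x ≡ just y)
just? nothing  = no λ ()
just? (just y) = yes (y , refl)

finite-× : ∀ {A B : Set} {m n} → A ↔ Fin m → B ↔ Fin n → (A × B) ↔ Fin (m * n)
finite-× e f = ↔-trans (e ×-↔ f) (↔-sym Finₚ.*↔×)

countTrue-1-⇔ : (f : Fin 1 → Bool) → T ⌊ countTrue f ℕ.≟ 1 ⌋ ⇔ f zero ≡ true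
countTrue-1-⇔ f with f zero
... | true  = mk⇔ (λ _ → refl) _
... | false = mk⇔ (λ ()) (λ ())

finite-S : ∀ {a b} (M : TwoGSM a b) → ∃ λ N → Micro.S M ↔ Fin N
finite-S M = _ , ↔-trans
  (↔-refl ⊎-↔ finite-× (finite-× ↔-refl (↔-sym Finₚ.2↔Bool)) ↔-refl) (↔-sym Finₚ.+↔⊎)

finite-copies : ∀ {a b} (M : TwoGSM a b) K → ∃ λ N → (Bool × (Micro.S M × Fin (suc K))) ↔ Fin N
finite-copies M K = _ , finite-× (↔-sym Finₚ.2↔Bool) (finite-× (proj₂ (finite-S M)) ↔-refl)

module Encoding {a b : ℕ} (M : TwoGSM a b) (K nc : ℕ)
  (copies : (Bool × (Micro.S M × Fin (suc K))) ↔ Fin nc) where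
  open TwoGSM M
  open Micro M
  open Stringness {a} using (stringF; string-⟺)

  _≟S_ : DecidableEquality S
  _≟S_ = via-injection (↔⇒↣ (proj₂ (finite-S M))) Fin._≟_

  flag : Fin nc → Bool
  flag c = proj₁ (Inverse.from copies c)

  state : Fin nc → S
  state c = proj₁ (proj₂ (Inverse.from copies c))

  slotOf : Fin nc → Fin (suc K)
  slotOf c = proj₂ (proj₂ (Inverse.from copies c))

  copy-≡ : ∀ {c d} → flag c ≡ flag d → state c ≡ state d → slotOf c ≡ slotOf d → c ≡ d
  copy-≡ {c} {d} p q r = trans (≡-sym (Inverse.strictlyInverseˡ copies c))
    (trans (cong (Inverse.to copies) (cong₂ _,_ p (cong₂ _,_ q r))) (Inverse.strictlyInverseˡ copies d))

  copy : ∀ f s k → ∃ λ c → flag c ≡ f × state c ≡ s × slotOf c ≡ k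
  copy f s k = Inverse.to copies (f , s , k) , cong proj₁ e , cong (proj₁ ∘ proj₂) e , cong (proj₂ ∘ proj₂) e
    where e = Inverse.strictlyInverseʳ copies (f , s , k)

  startC : Fin nc
  startC = proj₁ (copy false (inj₁ q-in) zero)

  Final Out : Fin nc → Set
  Final c = state c ≡ inj₁ q-f
  Out c   = (∃ λ γ → emission (state c) ≡ just γ) ⊎ Final c

  out? : ∀ c → Dec (Out c)
  out? c = just? (emission (state c)) ⊎-dec (state c ≟S inj₁ q-f)

  Written : Rule → Fin (suc bound) → Rule → Fin (suc bound) → Set
  Written ρ t ρ′ t′ = (∃ λ γ → nth (α ρ) (toℕ t) ≡ just γ) × ρ ≡ ρ′ × toℕ t′ ≡ suc (toℕ t)

  written? : ∀ ρ t ρ′ t′ → Dec (Written ρ t ρ′ t′)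
  written? ρ t ρ′ t′ = just? _ ×-dec (≡-dec Fin._≟_ Bool._≟_ ρ ρ′) ×-dec (toℕ t′ ℕ.≟ suc (toℕ t))

  private
    F : ℕ → ℕ → Set
    F = Form 1 a

    Param : Set
    Param = Fin (nc * nc)

  next : Fin nc → Fin nc → Param
  next = combine

  guardF : ∀ {i j} → Rule → Bool → Fin i → F i j
  guardF (ι , true)  f x = symbolF (Instr.σ (lookup δ ι)) f x
  guardF (ι , false) f x = neg (symbolF (Instr.σ (lookup δ ι)) f x)

  linkF : ∀ {i j} → Bool → S → Bool → S → Fin i → Fin i → F i j
  linkF f (inj₁ q)       f′ (inj₁ q′)        x y = ff
  linkF f (inj₁ q)       f′ (inj₂ (ρ , t))   x y =
    when ((src ρ Fin.≟ q) ×-dec (t Fin.≟ zero)) (and (guardF ρ f x) (sameF f f′ x y))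
  linkF f (inj₂ (ρ , t)) f′ (inj₂ (ρ′ , t′)) x y = when (written? ρ t ρ′ t′) (sameF f f′ x y)
  linkF f (inj₂ (ρ , t)) f′ (inj₁ q)         x y =
    when (nothing? (nth (α ρ) (toℕ t)) ×-dec (dst ρ Fin.≟ q)) (moveF (dir ρ) f f′ x y)

  -- The set with index next c d holds the nodes whose copy c is followed by copy d of some node.
  stepF : ∀ {i j} → (Param → Fin j) → Fin nc → Fin nc → Fin i → Fin i → F i j
  stepF r c d x y = and (mem x (r (next c d))) (linkF (flag c) (state c) (flag d) (state d) x y)

  silentF : ∀ {i j} → (Param → Fin j) → Fin nc → Fin nc → Fin i → Fin i → F i j
  silentF r c d x y = when (nothing? (emission (state c))) (stepF r c d x y)

  module StepReach   = Reach {1} {a} {nc} {Param} stepF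
  module SilentReach = Reach {1} {a} {nc} {Param} silentF

  -- Uniqueness is asked for the copy only. The node of the successor follows: the step determines
  -- its position, and position and flag determine the node.
  functionalF : ∀ {i} → F i (nc * nc)
  functionalF = all₁ (⋀ λ c → ⋀ λ d → ⋀ λ d′ → imp
    (and (mem zero (next c d)) (mem zero (next c d′))) (when (d Fin.≟ d′) (eq zero zero)))

  acceptF : ∀ {i} → F i (nc * nc)
  acceptF = ex₁ (ex₁ (⋁ λ c → and (firstF (suc zero))
    (when (state c ≟S inj₁ q-f) (StepReach.reachF id startC c (suc zero) zero))))

  nodeF : Fin nc → F 1 (nc * nc)
  nodeF c = when (out? c) (ex₁ (and (firstF zero) (StepReach.reachF id startC c zero (suc zero))))

  -- One emitting step followed by silent steps. The formula may also hold for a target inside a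
  -- silent stretch, but such a vertex violates `nodeF` and is not in the output.
  edgeF : Fin nc → Fin nc → Fin b → F 2 (nc * nc)
  edgeF c d γ = when (Maybeₚ.≡-dec Fin._≟_ (emission (state c)) (just γ))
    (ex₁ (⋁ λ e → and (stepF id c e (suc zero) zero) (SilentReach.reachF id e d zero (suc (suc zero)))))

  Tr : MSOT 1 a 1 b
  Tr = record
    { k = nc * nc ; dom = and stringF (and functionalF acceptF) ; nc = nc
    ; nodeF = λ c _ → nodeF c ; edgeF = edgeF }

  module _ {w : List (Fin a)} where

    choose-⇔ : ∀ {q i ρ t j} → (∃ λ o → Link w (inj₁ q , i) o (inj₂ (ρ , t) , j)) ⇔
      ((src ρ ≡ q × t ≡ zero) × Guard ρ (tape w i) × i ≡ j)
    choose-⇔ = mk⇔ (λ { (_ , choose e g) → (e , refl) , g , refl })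
                   (λ { ((e , refl) , g , refl) → _ , choose e g })

    write-⇔ : ∀ {i ρ t ρ′ t′ j} → (∃ λ o → Link w (inj₂ (ρ , t) , i) o (inj₂ (ρ′ , t′) , j)) ⇔
      (Written ρ t ρ′ t′ × i ≡ j)
    write-⇔ = mk⇔ (λ { (_ , write e t≡) → ((_ , e) , refl , t≡) , refl })
                  (λ { (((_ , e) , refl , t≡) , refl) → _ , write e t≡ })

    leave-⇔ : ∀ {i ρ t q j} → j ≤ suc (length w) → (∃ λ o → Link w (inj₂ (ρ , t) , i) o (inj₁ q , j)) ⇔
      ((nth (α ρ) (toℕ t) ≡ nothing × dst ρ ≡ q) × move (dir ρ) i ≡ just j)
    leave-⇔ l = mk⇔ (λ { (_ , leave e d m _) → (e , d) , m }) (λ { ((e , d) , m) → _ , leave e d m l })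

    link-target : ∀ {s i o s′ j o′ j′} → Link w (s , i) o (s′ , j) → Link w (s , i) o′ (s′ , j′) → j ≡ j′
    link-target (choose _ _)    (choose _ _)     = refl
    link-target (write _ _)     (write _ _)      = refl
    link-target (leave _ _ m _) (leave _ _ m′ _) = Maybeₚ.just-injective (trans (≡-sym m) m′)

  module Semantics {g : Graph 1 a} {w : List (Fin a)} (iso : g ≅ toStructure (egr w))
    (U : Param → Fin (Graph.n g) → Bool) where
    open Graph g using (n)
    open StringGraph {a} {g} {w} iso using (pos; pos-injective)
    open TapeFormulas {a} {g} {w} iso

    V : Set
    V = Fin n × Fin nc

    R : V → Maybe (Fin b) → V → Set
    R (u , c) o (v , d) = U (next c d) u ≡ true × Link w (state c , P u (flag c)) o (state d , P v (flag d))

    Step : V → V → Set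
    Step x y = ∃ λ o → R x o y

    module _ {i j : ℕ} {ρ : Fin i → Fin n} {η : Fin j → Fin n → Bool} where

      guard-⟺ : ∀ r f x → eval g (guardF r f x) ρ η ⟺ Guard r (tape w (P (ρ x) f))
      guard-⟺ (ι , true)  f x = symbol-⟺ (Instr.σ (lookup δ ι)) f x
      guard-⟺ (ι , false) f x = ⟺-map forth (λ { (τ , e , ≢) e′ → ≢ (Maybeₚ.just-injective (trans (≡-sym e) e′)) })
        (not-⟺ (symbol-⟺ (Instr.σ (lookup δ ι)) f x))
        where
        -- The negated formula only denies that the cell holds this symbol; that it holds some
        -- symbol comes from `tape-defined`.
        forth : tape w (P (ρ x) f) ≢ just (Instr.σ (lookup δ ι)) → Guard (ι , false) (tape w (P (ρ x) f))
        forth ≢ with τ , e ← tape-defined w (P (ρ x) f) (P≤ (ρ x) f) =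
          τ , e , λ τ≡ → ≢ (trans e (cong just τ≡))

      link-⟺ : ∀ f s f′ s′ x y → eval g (linkF f s f′ s′ x y) ρ η ⟺
        (∃ λ o → Link w (s , P (ρ x) f) o (s′ , P (ρ y) f′))
      link-⟺ f (inj₁ q) f′ (inj₁ q′) x y = ⟺-map ⊥-elim (λ ()) (ff-⟺ g {ρ = ρ} {η})
      link-⟺ f (inj₁ q) f′ (inj₂ (r , t)) x y = ⟺-map (from choose-⇔) (to choose-⇔)
        (when-⟺ g ((src r Fin.≟ q) ×-dec (t Fin.≟ zero)) {ρ = ρ} {η}
          (∧-⟺ (guard-⟺ r f x) (same-⟺ f f′ x y)))
      link-⟺ f (inj₂ (r , t)) f′ (inj₂ (r′ , t′)) x y = ⟺-map (from write-⇔) (to write-⇔)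
        (when-⟺ g (written? r t r′ t′) {ρ = ρ} {η} (same-⟺ f f′ x y))
      link-⟺ f (inj₂ (r , t)) f′ (inj₁ q) x y =
        ⟺-map (from (leave-⇔ (P≤ (ρ y) f′))) (to (leave-⇔ (P≤ (ρ y) f′)))
        (when-⟺ g (nothing? (nth (α r) (toℕ t)) ×-dec (dst r Fin.≟ q)) {ρ = ρ} {η}
          (move-⟺ (dir r) f f′ x y))

    step-⟺ : ∀ {i j} (r : Param → Fin j) c d x y (ρ : Fin i → Fin n) η → (∀ p → η (r p) ≗ U p) →
      eval g (stepF r c d x y) ρ η ⟺ Step (ρ x , c) (ρ y , d)
    step-⟺ r c d x y ρ η r≗ = ⟺-map (λ (h , o , l) → o , h , l) (λ (o , h , l) → h , o , l)
      (∧-⟺ (mk⇔ (trans (≡-sym e)) (trans e)) (link-⟺ (flag c) (state c) (flag d) (state d) x y))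
      where e = r≗ (next c d) (ρ x)

    silent-⟺ : ∀ {i j} (r : Param → Fin j) c d x y (ρ : Fin i → Fin n) η → (∀ p → η (r p) ≗ U p) →
      eval g (silentF r c d x y) ρ η ⟺ R (ρ x , c) nothing (ρ y , d)
    silent-⟺ r c d x y ρ η r≗ = ⟺-map
      (λ (e , o , h , l) → h , subst (λ o → Link w _ o _) (trans (link-emission w l) e) l)
      (λ (h , l) → ≡-sym (link-emission w l) , _ , h , l)
      (when-⟺ g (nothing? (emission (state c))) {ρ = ρ} {η} (step-⟺ r c d x y ρ η r≗))

    step? : ∀ x y → Dec (Step x y)
    step? (u , c) (v , d) = ⟺-dec (step-⟺ id c d zero (suc zero) (two u v) U λ _ _ → refl)

    silent? : ∀ x y → Dec (R x nothing y)
    silent? (u , c) (v , d) = ⟺-dec (silent-⟺ id c d zero (suc zero) (two u v) U λ _ _ → refl)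

    Functional : Set
    Functional = ∀ u c d d′ → U (next c d) u ≡ true × U (next c d′) u ≡ true → d ≡ d′

    functional-⟺ : ∀ {i} (ρ : Fin i → Fin n) → eval g functionalF ρ U ⟺ Functional
    functional-⟺ ρ = all-allFin-⟺ n λ u → ⋀-⟺ g λ c → ⋀-⟺ g λ d → ⋀-⟺ g λ d′ →
      imp-⟺ (∧-⟺ (mk⇔ id id) (mk⇔ id id)) (⟺-map proj₁ (_, refl)
        (when-⟺ g (d Fin.≟ d′) {eq zero zero} {extend u ρ} {U} (⌊⌋-⟺ (u Fin.≟ u))))

    Accepts : Set
    Accepts = ∃ λ x → ∃ λ y → ∃ λ c → pos x ≡ 0 × Final c × Star Step (x , startC) (y , c)

    stepReach-⟺ : ∀ {i} c d x y (ρ : Fin i → Fin n) →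
      eval g (StepReach.reachF id c d x y) ρ U ⟺ Star Step (ρ x , c) (ρ y , d)
    stepReach-⟺ c d x y ρ = StepReach.reach-⟺ g U {Step} step? step-⟺ id c d x y ρ U λ _ _ → refl

    silentReach-⟺ : ∀ {i} c d x y (ρ : Fin i → Fin n) →
      eval g (SilentReach.reachF id c d x y) ρ U ⟺ Star (λ x y → R x nothing y) (ρ x , c) (ρ y , d)
    silentReach-⟺ c d x y ρ =
      SilentReach.reach-⟺ g U {λ x y → R x nothing y} silent? silent-⟺ id c d x y ρ U λ _ _ → refl

    accept-⟺ : ∀ {i} (ρ : Fin i → Fin n) → eval g acceptF ρ U ⟺ Accepts
    accept-⟺ ρ = any-allFin-⟺ n λ x → any-allFin-⟺ n λ y → ⋁-⟺ g λ c →
      ∧-⟺ (first-⟺ (suc zero)) (when-⟺ g (state c ≟S inj₁ q-f) {ρ = extend y (extend x ρ)} {U}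
        (stepReach-⟺ startC c (suc zero) zero (extend y (extend x ρ))))

    node-⟺ : ∀ c (ρ : Fin 1 → Fin n) → eval g (nodeF c) ρ U ⟺
      (Out c × ∃ λ x → pos x ≡ 0 × Star Step (x , startC) (ρ zero , c))
    node-⟺ c ρ = when-⟺ g (out? c) {ρ = ρ} {U} (any-allFin-⟺ n λ x →
      ∧-⟺ (first-⟺ zero) (stepReach-⟺ startC c zero (suc zero) (extend x ρ)))

    module _ (functional : Functional) where

      -- The letter is fixed by the source state, the target copy by `functional`, and the target
      -- node by its position together with the flag of that copy.
      det : ∀ {x o y o′ y′} → R x o y → R x o′ y′ → o ≡ o′ × y ≡ y′
      det {u , c} {y = v , d} {y′ = v′ , d′} (h , l) (h′ , l′) with refl ← functional u c d d′ (h , h′) =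
        trans (link-emission w l) (≡-sym (link-emission w l′)) ,
        cong (_, d) (P-injective (flag d) (link-target l l′))

      stuck : ∀ {x o y} → Final (proj₂ x) → ¬ R x o y
      stuck {u , c} {o} {v , d} F (_ , l) = link-≢-final w
        (subst (λ s → Link w (s , P u (flag c)) o (state d , P v (flag d))) F l)

      silent-inside : ∀ {x y} → R x nothing y → ¬ Out (proj₂ x)
      silent-inside         (_ , l) (inj₁ (γ , e)) = contradiction (trans (link-emission w l) e) λ ()
      silent-inside {x} {y} s       (inj₂ F)       = stuck {x} {nothing} {y} F s

      open Contract R (Out ∘ proj₂) (Final ∘ proj₂)
        (λ {x} {o} {y} {o′} {y′} → det {x} {o} {y} {o′} {y′}) (λ {x} {o} {y} → stuck {x} {o} {y})
        (λ {x} {γ} {y} (_ , l) → inj₁ (γ , ≡-sym (link-emission w l)))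
        (λ {x} {y} → silent-inside {x} {y})
        inj₂
        using (Edge; node; node-reachable; node-out; node-injective; node-surjective; edge-intro; edge-elim)

      edges-⟺ : ∀ c d γ (ρ : Fin 2 → Fin n) →
        eval g (edgeF c d γ) ρ U ⟺ Edge (ρ zero , c) γ (ρ (suc zero) , d)
      edges-⟺ c d γ ρ = ⟺-map
        (λ (e , v , c′ , (o , h , l) , ss) →
          (v , c′) , (h , subst (λ o → Link w _ o _) (trans (link-emission w l) e) l) , ss)
        (λ ((v , c′) , (h , l) , ss) → ≡-sym (link-emission w l) , v , c′ , (_ , h , l) , ss)
        (when-⟺ g (Maybeₚ.≡-dec Fin._≟_ (emission (state c)) (just γ)) {ρ = ρ} {U}
          (any-allFin-⟺ n λ v → ⋁-⟺ g λ e → ∧-⟺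
            (step-⟺ id c e (suc zero) zero (extend v ρ) U λ _ _ → refl)
            (silentReach-⟺ e d zero (suc (suc zero)) (extend v ρ))))

      egr≅out : ∀ {x y c z} → pos x ≡ 0 → Final c → Walk R (x , startC) (y , c) z → egr z ≅ outT Tr g U
      egr≅out {x} {y} {c} {z} first F W = record
        { iso      = mk↔ₛ′ to-node from-node to-from
                       (λ i → node-injective F W (proj₂ (surjective (to-node i))))
        ; labPres  = λ i → lab≡ i
        ; edgePres = λ i γ j → ⟺-≡ (egr-edge-⟺ z i γ j)
            (edges-⟺ (proj₂ (node W i)) (proj₂ (node W j)) γ (two (proj₁ (node W i)) (proj₁ (node W j))))
            (λ (p , q) → edge-intro W i j p q) (edge-elim F W i j) }
        where
        isNode-⟺ : ∀ u c → T ⌊ countTrue {1} (λ _ → eval g (nodeF c) (λ _ → u) U) ℕ.≟ 1 ⌋ ⇔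
          (Out c × ∃ λ x → pos x ≡ 0 × Star Step (x , startC) (u , c))
        isNode-⟺ u c = mk⇔
          (to (node-⟺ c (λ _ → u)) ∘ to (countTrue-1-⇔ (λ _ → eval g (nodeF c) (λ _ → u) U)))
          (from (countTrue-1-⇔ (λ _ → eval g (nodeF c) (λ _ → u) U)) ∘ from (node-⟺ c (λ _ → u)))

        on-path : ∀ i → Out (proj₂ (node W i)) × ∃ λ x → pos x ≡ 0 × Star Step (x , startC) (node W i)
        on-path i = node-out F W i , x , first , node-reachable W i

        Node : Set
        Node = Structure.V (outT Tr g U)

        to-node : Fin (suc (length z)) → Node
        to-node i = node W i , from (isNode-⟺ _ _) (on-path i)

        surjective : ∀ (v : Node) → ∃ λ i → node W i ≡ proj₁ v
        surjective ((u , c) , t) = let o , _ , p , ss = to (isNode-⟺ u c) t in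
          node-surjective F W (subst (λ x → Star Step (x , startC) (u , c))
            (pos-injective (trans p (≡-sym first))) ss) o

        from-node : Node → Fin (suc (length z))
        from-node v = proj₁ (surjective v)

        to-from : ∀ v → to-node (from-node v) ≡ v
        to-from v = Node-≡ (proj₂ (surjective v))
          where
          Node-≡ : ∀ {v v′ : Node} → proj₁ v ≡ proj₁ v′ → v ≡ v′
          Node-≡ {v , t} {.v , t′} refl = cong (v ,_) (Boolₚ.T-irrelevant t t′)

        lab≡ : ∀ i → eval g (nodeF (proj₂ (node W i))) (λ _ → proj₁ (node W i)) U ≡ true
        lab≡ i = from (node-⟺ (proj₂ (node W i)) (λ _ → proj₁ (node W i))) (on-path i)

    -- Soundness of an arbitrary guess: forgetting parameters and slots leaves a walk of the split
    -- machine, which `walk⇒run` turns into a computation.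
    walk-links : ∀ {x y z} → Walk R x y z →
      Walk (Link w) (state (proj₂ x) , P (proj₁ x) (flag (proj₂ x))) (state (proj₂ y) , P (proj₁ y) (flag (proj₂ y))) z
    walk-links done               = done
    walk-links (silent (_ , l) W) = silent l (walk-links W)
    walk-links (loud (_ , l) W)   = loud l (walk-links W)

    accepts⇒run : ∀ {x y c z} → pos x ≡ 0 → Final c → Walk R (x , startC) (y , c) z → Realized M w z
    accepts⇒run {x} {y} {c} {z} first F W = walk⇒run w (subst₂ (λ s t → Walk (Link w) s t z)
      (cong₂ _,_ (proj₁ (proj₂ (proj₂ start))) (trans (cong (λ f → offset f (pos x)) (proj₁ (proj₂ start))) first))
      (cong (_, P y (flag c)) F)
      (walk-links W))
      where start = copy false (inj₁ q-in) zero

-- Guessing a computation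

module Guess {a b : ℕ} (M : TwoGSM a b) (K nc : ℕ)
  (copies : (Bool × (Micro.S M × Fin (suc K))) ↔ Fin nc)
  {g : Graph 1 a} {w : List (Fin a)} (iso : g ≅ toStructure (egr w)) where
  open TwoGSM M
  open Micro M
  open Encoding M K nc copies
  open Graph g using (n)
  open StringGraph {a} {g} {w} iso using (pos; at; pos≤)
  open TapeFormulas {a} {g} {w} iso using (P)

  private
    Vertex : Set
    Vertex = (S × ℕ) × ℕ

  -- Fixes one of the possible representations of a cell, with the flag reserved for the last one.
  -- Without a fixed choice the same successor could be guessed in two copies.
  atEnd : ℕ → Bool
  atEnd p = not ⌊ p ℕ.≤? length w ⌋

  represent : ∀ p → p ≤ suc (length w) → ∃ λ u → P u (atEnd p) ≡ p
  represent p p≤ with p ℕ.≤? length w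
  ... | yes p≤′ = at p p≤′
  ... | no  p≰  with u , e ← at (length w) ℕₚ.≤-refl =
    u , trans (cong suc e) (≡-sym (ℕₚ.≤-antisym p≤ (ℕₚ.≰⇒> p≰)))

  -- The source is described completely, the target only by its copy: a parameter set stores source
  -- nodes, and the node of the target is recovered from the step.
  Match : Fin n → Fin nc → Fin nc → Vertex × Vertex → Set
  Match u c d (((s , i) , k) , ((s′ , i′) , k′)) =
    (state c ≡ s × P u (flag c) ≡ i × toℕ (slotOf c) ≡ k) × (state d ≡ s′ × flag d ≡ atEnd i′ × toℕ (slotOf d) ≡ k′)

  match? : ∀ u c d p → Dec (Match u c d p)
  match? u c d (((s , i) , k) , ((s′ , i′) , k′)) =
    ((state c ≟S s) ×-dec (P u (flag c) ℕ.≟ i) ×-dec (toℕ (slotOf c) ℕ.≟ k)) ×-dec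
    ((state d ≟S s′) ×-dec (flag d Bool.≟ atEnd i′) ×-dec (toℕ (slotOf d) ℕ.≟ k′))

  module _ (ps : List (Vertex × Vertex)) where

    guess : Fin (nc * nc) → Fin n → Bool
    guess p u = ⌊ Any.any? (match? u (proj₁ (remQuot {nc} nc p)) (proj₂ (remQuot {nc} nc p))) ps ⌋

    guess-⟺ : ∀ c d u → guess (next c d) u ⟺ (∃ λ p → p ∈ ps × Match u c d p)
    guess-⟺ c d u = ⟺-map
      (λ h → let p , p∈ , m = find h in p , p∈ , subst (λ (c , d) → Match u c d p) (Finₚ.remQuot-combine {nc} {nc} c d) m)
      (λ (p , p∈ , m) → lose p∈ (subst (λ (c , d) → Match u c d p) (≡-sym (Finₚ.remQuot-combine {nc} {nc} c d)) m))
      (⌊⌋-⟺ (Any.any? (match? u (proj₁ (remQuot {nc} nc (next c d))) (proj₂ (remQuot {nc} nc (next c d)))) ps))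

    open Semantics {g} {w} iso guess using (R; Functional)

    -- A node and a copy determine the vertex they represent, so both guesses come from the same
    -- source in `ps` and have the same target; its state, slot and prescribed flag determine the
    -- copy.
    guess-functional : (∀ {x y y′} → (x , y) ∈ ps → (x , y′) ∈ ps → y ≡ y′) → Functional
    guess-functional f u c d d′ (h , h′)
      with _ , p∈ , (refl , refl , refl) , refl , fd , sd ← to (guess-⟺ c d u) h
         | _ , p∈′ , (refl , refl , refl) , sd′ , fd′ , kd′ ← to (guess-⟺ c d′ u) h′
      with refl ← f p∈ p∈′ = copy-≡ (trans fd (≡-sym fd′)) (≡-sym sd′) (Finₚ.toℕ-injective (trans sd (≡-sym kd′)))

    step-guessed : ∀ {u c v d k k′ s i s′ i′} o → ((((s , i) , k) , ((s′ , i′) , k′)) ∈ ps) →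
      state c ≡ s → P u (flag c) ≡ i → toℕ (slotOf c) ≡ k →
      state d ≡ s′ → P v (flag d) ≡ i′ → flag d ≡ atEnd i′ → toℕ (slotOf d) ≡ k′ →
      Link w (s , i) o (s′ , i′) → R (u , c) o (v , d)
    step-guessed {u} {c} {v} {d} o p∈ refl refl refl refl refl fd refl l =
      from (guess-⟺ c d u) (_ , p∈ , (refl , refl , refl) , (refl , fd , refl)) , l

    vertex : ∀ s {i k} → i ≤ suc (length w) → k ≤ K → ∃ λ v → ∃ λ d →
      state d ≡ s × P v (flag d) ≡ i × flag d ≡ atEnd i × toℕ (slotOf d) ≡ k
    vertex s {i} {k} i≤ k≤ with d , de , e , q ← copy (atEnd i) s (fromℕ< (s≤s k≤)) | v , p ← represent i i≤ =
      v , d , e , trans (cong (P v) de) p , de , trans (cong toℕ q) (Finₚ.toℕ-fromℕ< (s≤s k≤))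

    -- Each next vertex is represented by `vertex`. Its slot is a number of visits, so the visit
    -- bound `K` is what makes it fit into `Fin (suc K)`.
    walk-guessed : ∀ {s i t j z u c k} (W : Walk (Link w) (s , i) (t , j) z) →
      (∀ {p} → p ∈ pairs w W k → p ∈ ps) → (∀ p → visits p (positions w W) ≤ K) →
      i ≤ suc (length w) → state c ≡ s → P u (flag c) ≡ i → toℕ (slotOf c) ≡ k →
      ∃ λ v → ∃ λ d → state d ≡ t × Walk R (u , c) (v , d) z
    walk-guessed done ⊆ visits≤ i≤ s≡ i≡ k≡ = _ , _ , s≡ , done
    walk-guessed {i = i} (silent {y = s′ , i′} l W) ⊆ visits≤ i≤ s≡ i≡ k≡ =
      let visits≤′ = λ p → ℕₚ.≤-trans (visits-mono p i (positions w W)) (visits≤ p)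
          v , d , ds , dp , df , dk = vertex s′ (link-bounded w i≤ l) (visits≤′ i′)
          v′ , d′ , e , W′ = walk-guessed W (⊆ ∘ Any.there) visits≤′ (link-bounded w i≤ l) ds dp dk
      in v′ , d′ , e , silent (step-guessed nothing (⊆ (Any.here refl)) s≡ i≡ k≡ ds dp df dk l) W′
    walk-guessed {i = i} (loud {y = s′ , i′} l W) ⊆ visits≤ i≤ s≡ i≡ k≡ =
      let visits≤′ = λ p → ℕₚ.≤-trans (visits-mono p i (positions w W)) (visits≤ p)
          v , d , ds , dp , df , dk = vertex s′ (link-bounded w i≤ l) (visits≤′ i′)
          v′ , d′ , e , W′ = walk-guessed W (⊆ ∘ Any.there) visits≤′ (link-bounded w i≤ l) ds dp dk
      in v′ , d′ , e , loud (step-guessed (just _) (⊆ (Any.here refl)) s≡ i≡ k≡ ds dp df dk l) W′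

-- Isomorphisms and correctness of the transduction

≅-trans : ∀ {S G} {h g : Graph S G} {K : Structure S G} → h ≅ toStructure g → g ≅ K → h ≅ K
≅-trans {h = h} {g} {K} p q = record
  { iso      = ↔-trans (_≅_.iso p) (_≅_.iso q)
  ; labPres  = λ u → subst (λ σ → Structure.hasLab K (_≅_.f q (_≅_.f p u)) σ ≡ true)
      (to (⌊⌋-⟺ (Graph.lab g (_≅_.f p u) Fin.≟ Graph.lab h u)) (_≅_.labPres p u)) (_≅_.labPres q _)
  ; edgePres = λ u γ v → trans (_≅_.edgePres p u γ v) (_≅_.edgePres q _ γ _) }

-- Stated for one node label: a node of `K` may satisfy several labels, so in general `h` and `g`
-- could label it differently.
≅-cospan : ∀ {G} {h g : Graph 1 G} {K : Structure 1 G} → h ≅ K → g ≅ K → h ≅ toStructure g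
≅-cospan {G} {h} {g} {K} p q = record
  { iso      = ↔-trans (_≅_.iso p) (↔-sym (_≅_.iso q))
  ; labPres  = λ u → from (⌊⌋-⟺ (_ Fin.≟ _)) (unlabelled _ _)
  ; edgePres = λ u γ v → trans (_≅_.edgePres p u γ v) (≡-sym (trans (_≅_.edgePres q _ γ _)
      (cong₂ (λ x y → Structure.edge K x γ y)
        (Inverse.strictlyInverseˡ (_≅_.iso q) _) (Inverse.strictlyInverseˡ (_≅_.iso q) _)))) }
  where
  unlabelled : (σ τ : Fin 1) → σ ≡ τ
  unlabelled zero zero = refl

egr-self : ∀ {a} (w : List (Fin a)) → egr w ≅ toStructure (egr w)
egr-self w = record { iso = ↔-refl ; labPres = λ _ → refl ; edgePres = λ _ _ _ → refl }

-- Stated for all environments ρ because an absurd λ is equal to no other absurd λ.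
NMSO-intro : ∀ {a b} {m : Transduction a b} (Tr : MSOT 1 a 1 b) →
  (∀ g h ρ U → eval g (MSOT.dom Tr) ρ U ≡ true → h ≅ outT Tr g U →
    ∃ λ w → ∃ λ z → m w z × g ≅ toStructure (egr w) × h ≅ toStructure (egr z)) →
  (∀ g h → (∃ λ w → ∃ λ z → m w z × g ≅ toStructure (egr w) × h ≅ toStructure (egr z)) →
    ∃ λ U → (∀ ρ → eval g (MSOT.dom Tr) ρ U ≡ true) × h ≅ outT Tr g U) →
  NMSO-e m
NMSO-intro Tr forth back = Tr , λ g h → mk⇔
  (λ (U , dom , out) → forth g h _ U dom out)
  (λ related → let U , dom , out = back g h related in U , dom _ , out)

module Correctness {a b : ℕ} {m : Transduction a b} (M : TwoGSM a b) (k : ℕ)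
  (visiting : ∀ w z → Realized M w z → ∃ λ ps → Run M w (TwoGSM.q-in M) 0 z ps × KVisiting k ps)
  (realizes : RealizesT M m) (K nc : ℕ) (k≤K : k * (2 + Micro.bound M) ≤ K)
  (copies : (Bool × (Micro.S M × Fin (suc K))) ↔ Fin nc) where
  open TwoGSM M
  open Micro M
  open Encoding M K nc copies
  open Stringness {a} using (stringF; string-⟺)

  Param : Set
  Param = Fin (nc * nc)

  accepting-guess : ∀ {g h w} → g ≅ toStructure (egr w) → (U : Param → Fin (Graph.n g) → Bool) →
    (ρ : Fin 0 → Fin (Graph.n g)) → eval g functionalF ρ U ≡ true → eval g acceptF ρ U ≡ true → h ≅ outT Tr g U →
    ∃ λ z → m w z × h ≅ toStructure (egr z)
  accepting-guess {g} {h} {w} iso U ρ fun acc out =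
    let open Semantics {g} {w} iso U
        functional = to (functional-⟺ ρ) fun
        x , y , c , first , final , ss = to (accept-⟺ ρ) acc
        z , W = star⇒walk ss
    in z , from (realizes w z) (accepts⇒run first final W) , ≅-cospan out (egr≅out functional first final W)

  image⇒related : ∀ g h ρ U → eval g (MSOT.dom Tr) ρ U ≡ true → h ≅ outT Tr g U →
    ∃ λ w → ∃ λ z → m w z × g ≅ toStructure (egr w) × h ≅ toStructure (egr z)
  image⇒related g h ρ U dom out =
    let (w , iso) , fun , acc = to (∧-⟺ (string-⟺ g ρ U)
          (∧-⟺ {eval g functionalF ρ U} (mk⇔ id id) (mk⇔ id id))) dom
        z , mwz , h≅ = accepting-guess {g} {h} {w} iso U ρ fun acc out
    in w , z , mwz , iso , h≅

  module Existence {g w j z} (iso : g ≅ toStructure (egr w))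
    (W : Walk (Link w) (inj₁ q-in , 0) (inj₁ q-f , j) z) (W≤ : ∀ p → visits p (positions w W) ≤ K) where
    open Guess M K nc copies {g} {w} iso
    open StringGraph {a} {g} {w} iso using (pos; at)

    U : Param → Fin (Graph.n g) → Bool
    U = guess (pairs w W 0)

    open Semantics {g} {w} iso U

    functional : Functional
    functional = guess-functional (pairs w W 0) (pairs-functional w W (inj₁ refl))

    x : Fin (Graph.n g)
    x = proj₁ (at 0 z≤n)

    x≡ : pos x ≡ 0
    x≡ = proj₂ (at 0 z≤n)

    reached : ∃ λ v → ∃ λ d → Final d × Walk R (x , startC) (v , d) z
    reached = let _ , f≡ , s≡ , k≡ = copy false (inj₁ q-in) zero in
      walk-guessed (pairs w W 0) {u = x} {c = startC} W id W≤ z≤n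
        s≡ (trans (cong (λ f → offset f (pos x)) f≡) x≡) (cong toℕ k≡)

    in-domain : ∀ ρ → eval g (MSOT.dom Tr) ρ U ≡ true
    in-domain ρ = let v , d , final , W′ = reached in
      from (∧-⟺ (string-⟺ g ρ U) (∧-⟺ (functional-⟺ ρ) (accept-⟺ ρ)))
        ((w , iso) , functional , x , v , d , x≡ , final , walk⇒star W′)

    egr≅image : egr z ≅ outT Tr g U
    egr≅image = let _ , _ , final , W′ = reached in egr≅out functional x≡ final W′

  related⇒image : ∀ g h → (∃ λ w → ∃ λ z → m w z × g ≅ toStructure (egr w) × h ≅ toStructure (egr z)) →
    ∃ λ U → (∀ ρ → eval g (MSOT.dom Tr) ρ U ≡ true) × h ≅ outT Tr g U
  related⇒image g h (w , z , mwz , iso , h≅) =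
    let ps , r , kvisiting = visiting w z (to (realizes w z) mwz)
        j , W , count = run⇒walk w r
        open Existence {g} {w} {j} {z} iso W (λ p →
          ℕₚ.≤-trans (count p) (ℕₚ.≤-trans (ℕₚ.*-monoˡ-≤ (2 + bound) (kvisiting p)) k≤K))
    in U , in-domain , ≅-trans h≅ egr≅image

  in-NMSO : NMSO-e m
  in-NMSO = NMSO-intro {m = m} Tr image⇒related related⇒image

finite-visit⇒NMSO : ∀ {a b} {m : Transduction a b} → NGSM-fin m → NMSO-e m
finite-visit⇒NMSO {m = m} (M , (k , visiting) , realizes) =
  Correctness.in-NMSO {m = m} M k visiting realizes (k * (2 + Micro.bound M)) _ ℕₚ.≤-refl
    (proj₂ (finite-copies M (k * (2 + Micro.bound M))))

-- Cutting loops

unique-lookup-injective : ∀ {A : Set} {xs : List A} → Unique xs → ∀ i j → lookup xs i ≡ lookup xs j → i ≡ j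
unique-lookup-injective (_ ∷ _)  zero    zero    e = refl
unique-lookup-injective (p ∷ _)  zero    (suc j) e = contradiction e (All.lookup p (∈-lookup j))
unique-lookup-injective (p ∷ _)  (suc i) zero    e = contradiction (≡-sym e) (All.lookup p (∈-lookup i))
unique-lookup-injective (_ ∷ ps) (suc i) (suc j) e = cong suc (unique-lookup-injective ps i j e)

unique-length≤ : ∀ {n} {xs : List (Fin n)} → Unique xs → length xs ≤ n
unique-length≤ u = Finₚ.injective⇒≤ λ {i} {j} → unique-lookup-injective u i j

-- Distinct configurations at the same position differ in their states, so the pigeonhole principle
-- applies to the states met at `i`.
visits-unique≤ : ∀ {n} {cs : List (Fin n × ℕ)} → Unique cs → ∀ i → visits i (map proj₂ cs) ≤ n
visits-unique≤ {n} {cs} u i = let qs , u′ , l , _ = states cs u in subst (_≤ n) l (unique-length≤ u′)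
  where
  states : ∀ (cs : List (Fin n × ℕ)) → Unique cs → ∃ λ qs →
    Unique qs × length qs ≡ visits i (map proj₂ cs) × All (λ q → (q , i) ∈ cs) qs
  states [] [] = [] , [] , refl , []
  states ((q , j) ∷ cs) (p ∷ u) with states cs u | j ℕ.≟ i in e
  ... | qs , u′ , l , qs∈ | yes refl = q ∷ qs ,
    All.map (λ q′∈ q≡ → All.lookup p q′∈ (cong (_, i) q≡)) qs∈ ∷ u′ ,
    trans (cong suc l) (≡-sym (visits-self i (map proj₂ cs))) ,
    Any.here refl ∷ All.map Any.there qs∈
  ... | qs , u′ , l , qs∈ | no j≢i = qs , u′ ,
    trans l (≡-sym (cong length (filter-reject (ℕ._≟ i) j≢i))) , All.map Any.there qs∈

power : ∀ {A : Set} → ℕ → List A → List A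
power zero    xs = []
power (suc n) xs = xs ++ power n xs

power-length : ∀ {A : Set} n (x : A) xs → n ≤ length (power n (x ∷ xs))
power-length zero    x xs = z≤n
power-length (suc n) x xs = s≤s (ℕₚ.≤-trans (power-length n x xs)
  (subst (length (power n (x ∷ xs)) ≤_) (≡-sym (length-++ xs)) (ℕₚ.m≤n+m _ _)))

module Pruning {a b : ℕ} (M : TwoGSM a b) (w : List (Fin a)) (B : ℕ)
  (bounded : ∀ z → Realized M w z → length z ≤ B) where
  open TwoGSM M

  Conf : Set
  Conf = Fin nQ × ℕ

  RunFrom : Conf → List (Fin b) → List ℕ → Set
  RunFrom (q , i) = Run M w q i

  -- A partial computation, represented by its action on continuations, because `Run` describes only
  -- computations that end in `q-f`. Composition of segments is then composition of functions.
  Segment : Conf → List (Fin b) → Conf → Set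
  Segment c y d = ∀ {z ps} → RunFrom d z ps → ∃ λ ps′ → RunFrom c (y ++ z) ps′

  _⨾_ : ∀ {c d e y y′} → Segment c y d → Segment d y′ e → Segment c (y ++ y′) e
  _⨾_ {c} {y = y} {y′} s s′ {z} r =
    subst (λ x → ∃ λ ps → RunFrom c x ps) (≡-sym (++-assoc y y′ z)) (s (proj₂ (s′ r)))

  iterate : ∀ n {c y} → Segment c y c → Segment c (power n y) c
  iterate zero    s r = _ , r
  iterate (suc n) {y = y} s = _⨾_ {y = y} s (iterate n s)

  -- A productive loop could be pumped beyond the bound.
  loop-silent : ∀ {c y₀ y z ps} → Segment (q-in , 0) y₀ c → Segment c y c → RunFrom c z ps → y ≡ []
  loop-silent {y = []} pre loop r = refl
  loop-silent {y₀ = y₀} {γ ∷ y} {z} pre loop r = contradiction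
    (bounded _ (pre (proj₂ (iterate (suc B) loop r))))
    (ℕₚ.<⇒≱ (begin
      suc B                                        ≤⟨ power-length (suc B) γ y ⟩
      length (power (suc B) (γ ∷ y))               ≤⟨ ℕₚ.m≤m+n _ _ ⟩
      length (power (suc B) (γ ∷ y)) + length z    ≡⟨ ≡-sym (length-++ (power (suc B) (γ ∷ y))) ⟩
      length (power (suc B) (γ ∷ y) ++ z)          ≤⟨ ℕₚ.m≤n+m _ _ ⟩
      length y₀ + length (power (suc B) (γ ∷ y) ++ z) ≡⟨ ≡-sym (length-++ y₀) ⟩
      length (y₀ ++ power (suc B) (γ ∷ y) ++ z)    ∎))
    where open ℕₚ.≤-Reasoning

  confs : ∀ {c z ps} → RunFrom c z ps → List Conf
  confs {c} halt                  = c ∷ []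
  confs {c} (step₁ _ _ _ _ _ r)   = c ∷ confs r
  confs {c} (step₀ _ _ _ _ _ _ r) = c ∷ confs r

  confs-positions : ∀ {c z ps} (r : RunFrom c z ps) → map proj₂ (confs r) ≡ ps
  confs-positions halt                  = refl
  confs-positions (step₁ _ _ _ _ _ r)   = cong (_ ∷_) (confs-positions r)
  confs-positions (step₀ _ _ _ _ _ _ r) = cong (_ ∷_) (confs-positions r)

  Simple : Conf → List (Fin b) → Set
  Simple c z = ∃ λ ps → Σ (RunFrom c z ps) λ r → Unique (confs r)

  Step : Conf → List (Fin b) → Conf → Set
  Step c y d = ∀ {z ps} (r : RunFrom d z ps) →
    ∃ λ ps′ → Σ (RunFrom c (y ++ z) ps′) λ r′ → confs r′ ≡ c ∷ confs r

  step⇒segment : ∀ {c y d} → Step c y d → Segment c y d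
  step⇒segment s r = let ps , r′ , _ = s r in ps , r′

  split : ∀ {c d z ps} (r : RunFrom c z ps) → Unique (confs r) → d ∈ confs r →
    ∃ λ y → ∃ λ z′ → z ≡ y ++ z′ × Segment c y d × Simple d z′
  split halt u (Any.here refl) = [] , _ , refl , (λ r → _ , r) , _ , halt , u
  split r@(step₁ _ _ _ _ _ _)   u (Any.here refl) = [] , _ , refl , (λ r → _ , r) , _ , r , u
  split r@(step₀ _ _ _ _ _ _ _) u (Any.here refl) = [] , _ , refl , (λ r → _ , r) , _ , r , u
  split (step₁ {ι = ι} ι∈ e t m l r) (_ ∷ u) (Any.there d∈) =
    let y , z′ , z≡ , s , simple = split r u d∈ in Instr.α₁ ι ++ y , z′ ,
      trans (cong (Instr.α₁ ι ++_) z≡) (≡-sym (++-assoc (Instr.α₁ ι) y z′)) ,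
      _⨾_ {y = Instr.α₁ ι} {y} (λ r → _ , step₁ ι∈ e t m l r) s , simple
  split (step₀ {ι = ι} ι∈ e t ≢ m l r) (_ ∷ u) (Any.there d∈) =
    let y , z′ , z≡ , s , simple = split r u d∈ in Instr.α₀ ι ++ y , z′ ,
      trans (cong (Instr.α₀ ι ++_) z≡) (≡-sym (++-assoc (Instr.α₀ ι) y z′)) ,
      _⨾_ {y = Instr.α₀ ι} {y} (λ r → _ , step₀ ι∈ e t ≢ m l r) s , simple

  -- If `c` recurs in the loop-free rest, the step and the part up to that recurrence form a loop at
  -- `c`. It is silent by `loop-silent`, so the suffix starting at the recurrence already has the
  -- whole output. The prefix `pre` makes the loop part of a computation from the initial
  -- configuration, where the output bound applies.
  simple-cons : ∀ {c d y₀ y z} → Segment (q-in , 0) y₀ c → Step c y d → Simple d z → Simple c (y ++ z)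
  simple-cons {c} {d} {y₀} {y} {z} pre s (ps , r , u) with Any.any? (≡-dec Fin._≟_ ℕ._≟_ c) (confs r)
  ... | no c∉ = let ps′ , r′ , e = s r in ps′ , r′ , subst Unique (≡-sym e) (Allₚ.¬Any⇒All¬ _ c∉ ∷ u)
  ... | yes c∈ = let y′ , z′ , z≡ , s′ , simple = split r u c∈
                     silent = loop-silent {c} {y₀} {y ++ y′} pre (_⨾_ {y = y} {y′} (step⇒segment {c} {y} s) s′)
                                (proj₁ (proj₂ simple))
    in subst (Simple c) (trans (cong (_++ z′) (≡-sym silent))
         (trans (++-assoc y y′ z′) (cong (y ++_) (≡-sym z≡)))) simple

  prune : ∀ {c y₀ z ps} → Segment (q-in , 0) y₀ c → RunFrom c z ps → Simple c z
  prune pre halt = _ , halt , [] ∷ []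
  prune {c} {y₀} pre (step₁ {ι = ι} {q} {i} {j} ι∈ e t m l r) = simple-cons {c} {y₀ = y₀} {Instr.α₁ ι} pre s
    (prune {_} {y₀ ++ Instr.α₁ ι} (_⨾_ {y = y₀} {Instr.α₁ ι} pre (step⇒segment {c} {Instr.α₁ ι} s)) r)
    where
    s : Step c (Instr.α₁ ι) (Instr.q₁ ι , j)
    s r = _ , step₁ ι∈ e t m l r , refl
  prune {c} {y₀} pre (step₀ {ι = ι} {q} {i} {j} ι∈ e t ≢ m l r) = simple-cons {c} {y₀ = y₀} {Instr.α₀ ι} pre s
    (prune {_} {y₀ ++ Instr.α₀ ι} (_⨾_ {y = y₀} {Instr.α₀ ι} pre (step⇒segment {c} {Instr.α₀ ι} s)) r)
    where
    s : Step c (Instr.α₀ ι) (Instr.q₀ ι , j)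
    s r = _ , step₀ ι∈ e t ≢ m l r , refl

  -- The bound `B` may vary with `w`, but it is used only to show that loops are silent; the visit
  -- bound is `nQ`.
  visiting-bounded : ∀ {z} → Realized M w z → ∃ λ ps → Run M w q-in 0 z ps × KVisiting nQ ps
  visiting-bounded (_ , r) = let ps , r′ , u = prune {_} {[]} (λ r → _ , r) r in
    ps , r′ , λ i → subst (λ ps → visits i ps ≤ nQ) (confs-positions r′) (visits-unique≤ u i)

-- Whatever the parameters are, the output nodes are pairs of an input node and a copy, and `egr z`
-- has one node more than `z` has letters.
NMSO-length≤ : ∀ {a b} {m : Transduction a b} ((Tr , _) : NMSO-e m) → ∀ {w z} → m w z →
  suc (length z) ≤ suc (length w) * MSOT.nc Tr
NMSO-length≤ (Tr , related) {w} {z} mwz =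
  let U , _ , h≅ = from (related (egr w) (egr z)) (w , z , mwz , egr-self w , egr-self z)
      module I = Inverse (_≅_.iso h≅)
      Node-≡ : ∀ {v v′ : Structure.V (outT Tr (egr w) U)} → proj₁ v ≡ proj₁ v′ → v ≡ v′
      Node-≡ = λ { {v , t} {_ , t′} refl → cong (v ,_) (Boolₚ.T-irrelevant t t′) }
  in Finₚ.injective⇒≤ {f = λ i → combine (proj₁ (proj₁ (I.to i))) (proj₂ (proj₁ (I.to i)))} λ {i} {j} e →
    let p , q = Finₚ.combine-injective _ _ _ _ e in
    trans (≡-sym (I.strictlyInverseʳ i)) (trans (cong I.from (Node-≡ (cong₂ _,_ p q))) (I.strictlyInverseʳ j))

-- The machine is kept: every 2gsm that realizes a transduction in `NMSO-e` is itself finite visit,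
-- with its number of states as bound.
NMSO⇒finite-visit : ∀ {a b} {m : Transduction a b} → NGSM m → NMSO-e m → NGSM-fin m
NMSO⇒finite-visit {m = m} (M , realizes) mso@(Tr , _) = M , (TwoGSM.nQ M , λ w z →
  Pruning.visiting-bounded M w (suc (length w) * MSOT.nc Tr) λ z r →
    ℕₚ.<⇒≤ (NMSO-length≤ {m = m} mso (from (realizes w z) r))) , realizes

theorem6p6 : (a b : ℕ) (m : Transduction a b) →
    (NGSM m × NMSO-e m) ⇔ NGSM-fin m
theorem6p6 a b m = mk⇔
  (λ (gsm , mso) → NMSO⇒finite-visit {m = m} gsm mso)
  (λ fin@(M , _ , realizes) → (M , realizes) , finite-visit⇒NMSO {m = m} fin)
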